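{- Let $r\ge 1$ and let $K$ be an $r$-dimensional finite simplicial complex. Then the largest eigenvalue $\lambda_{r-1,1}(K)$ of the $(r-1)$-dimensional up-Laplacian of $K$ satisfies \[ \lambda_{r-1,1}(K)\le\frac{r+1}{2}\,f_r(K)+\frac{f_{r-2}(K)}{r}. \]
   Context: A (finite abstract) simplicial complex $K$ on a finite vertex set $V$ is a collection of subsets of $V$ closed under inclusion. An element of cardinality $i+1$ is an $i$-face; the dimension of $K$ is the maximum dimension of its faces. $S_i(K)$ is the set of $i$-faces and $f_i(K)=|S_i(K)|$, with $S_{ -1}(K)=\{\emptyset\}$ and $f_{ -1}(K)=1$. Fix a linear order on $V$ and orient every face by the increasing order of its vertices. The $i$-th boundary map $\partial_i:C_i(K;\mathbb R)\to C_{i-1}(K;\mathbb R)$ between real chain spaces (with bases the oriented faces) is $\partial_i[v_0,\dots,v_i]=\sum_{j=0}^i(-1)^j[v_0,\dots,\widehat{v_j},\dots,v_i]$, and $B_i(K)\in\mathbb R^{f_{i-1}(K)\times f_i(K)}$ is its matrix. The $i$-dimensional up-Laplacian is $L_i^{\mathrm{up}}(K)=B_{i+1}(K)B_{i+1}(K)^\top$, and $\lambda_{i,1}(K)$ denotes its largest eigenvalue. -}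

module Defs where

open import Data.Bool.Base as Bool using (if_then_else_)
open import Data.Bool.Properties as Boolₚ using ()
open import Data.Fin.Base using (Fin; toℕ)
open import Data.Fin.Subset using (Subset; inside; outside; ⊥; _⊆_; _-_; ∣_∣)
open import Data.Fin.Subset.Properties using (_∈?_)
open import Data.Integer.Base as ℤ using (ℤ; +_; 1ℤ; -1ℤ)
open import Data.Integer.Properties as ℤₚ using ()
open import Data.List.Base using (List; []; _∷_; _++_; map; filter; length; lookup; allFin)
open import Data.Nat.Base as ℕ using (ℕ; zero; suc)
open import Data.Nat.Properties as ℕₚ using ()
open import Data.Product.Base using (∃; ∃-syntax; _×_; _,_)
open import Data.Rational.Base as ℚ using (ℚ; 0ℚ; 1ℚ; ½)
open import Data.Rational.Properties as ℚₚ using ()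
open import Data.Vec.Base using ([]; _∷_)
import Data.Vec.Functional as Vector
open import Data.Vec.Properties using (≡-dec)
open import Level using (0ℓ)
open import Relation.Binary.Definitions using (DecidableEquality)
open import Relation.Binary.PropositionalEquality using (_≡_; refl; sym; trans; cong; cong₂; subst; module ≡-Reasoning)
open import Relation.Nullary.Decidable using (does; dec⇒maybe; _×-dec_)
open import Relation.Nullary.Negation using (¬_)
open import Relation.Unary using (Pred; Decidable)
open import Tactic.RingSolver using (solve-∀)
open import Tactic.RingSolver.Core.AlmostCommutativeRing
  using (AlmostCommutativeRing; fromCommutativeRing)

------------------------------------------------------------------------
-- Real numbers, as Cauchy sequences of rationals up to _≈_

IsCauchy : (ℕ → ℚ) → Set
IsCauchy s = ∀ ε → 0ℚ ℚ.< ε →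
  ∃[ N ] (∀ m n → N ℕ.≤ m → N ℕ.≤ n → ℚ.∣ s m ℚ.- s n ∣ ℚ.≤ ε)

record ℝ : Set where
  constructor mkℝ
  field
    seq    : ℕ → ℚ
    cauchy : IsCauchy seq

open ℝ public

infix 4 _≈_ _≤_

_≈_ : ℝ → ℝ → Set
x ≈ y = ∀ ε → 0ℚ ℚ.< ε →
  ∃[ N ] (∀ n → N ℕ.≤ n → ℚ.∣ seq x n ℚ.- seq y n ∣ ℚ.≤ ε)

-- Holds of the real numbers represented, not termwise: x ≤ y + ε
-- eventually, for each rational ε > 0.
_≤_ : ℝ → ℝ → Set
x ≤ y = ∀ ε → 0ℚ ℚ.< ε →
  ∃[ N ] (∀ n → N ℕ.≤ n → seq x n ℚ.≤ seq y n ℚ.+ ε)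

fromℚ : ℚ → ℝ
fromℚ q = mkℝ (λ _ → q) λ ε 0<ε → 0 , λ _ _ _ _ →
  subst (λ d → ℚ.∣ d ∣ ℚ.≤ ε) (sym (ℚₚ.+-inverseʳ q)) (ℚₚ.<⇒≤ 0<ε)

private
  ℚ-ring : AlmostCommutativeRing 0ℓ 0ℓ
  ℚ-ring = fromCommutativeRing ℚₚ.+-*-commutativeRing λ p → dec⇒maybe (0ℚ ℚₚ.≟ p)

  half+half : ∀ ε → ½ ℚ.* ε ℚ.+ ½ ℚ.* ε ≡ ε
  half+half = solve-∀ ℚ-ring

  half>0 : ∀ {ε} → 0ℚ ℚ.< ε → 0ℚ ℚ.< ½ ℚ.* ε
  half>0 0<ε = ℚₚ.*-monoʳ-<-pos ½ 0<ε

  +-cauchy : ∀ s t → IsCauchy s → IsCauchy t → IsCauchy (λ n → s n ℚ.+ t n)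
  +-cauchy s t cs ct ε 0<ε
    with cs (½ ℚ.* ε) (half>0 0<ε) | ct (½ ℚ.* ε) (half>0 0<ε)
  ... | N₁ , p₁ | N₂ , p₂ = N₁ ℕ.⊔ N₂ , λ m n N≤m N≤n → begin
    ℚ.∣ (s m ℚ.+ t m) ℚ.- (s n ℚ.+ t n) ∣
      ≡⟨ cong ℚ.∣_∣ (rearrange (s m) (t m) (s n) (t n)) ⟩
    ℚ.∣ (s m ℚ.- s n) ℚ.+ (t m ℚ.- t n) ∣
      ≤⟨ ℚₚ.∣p+q∣≤∣p∣+∣q∣ (s m ℚ.- s n) (t m ℚ.- t n) ⟩
    ℚ.∣ s m ℚ.- s n ∣ ℚ.+ ℚ.∣ t m ℚ.- t n ∣
      ≤⟨ ℚₚ.+-mono-≤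
           (p₁ m n (ℕₚ.m⊔n≤o⇒m≤o N₁ N₂ N≤m) (ℕₚ.m⊔n≤o⇒m≤o N₁ N₂ N≤n))
           (p₂ m n (ℕₚ.m⊔n≤o⇒n≤o N₁ N₂ N≤m) (ℕₚ.m⊔n≤o⇒n≤o N₁ N₂ N≤n)) ⟩
    ½ ℚ.* ε ℚ.+ ½ ℚ.* ε
      ≡⟨ half+half ε ⟩
    ε ∎
    where
    open ℚₚ.≤-Reasoning
    rearrange : ∀ a b c d → (a ℚ.+ b) ℚ.- (c ℚ.+ d) ≡ (a ℚ.- c) ℚ.+ (b ℚ.- d)
    rearrange = solve-∀ ℚ-ring

  cauchy-bounded : ∀ s → IsCauchy s →
    ∃[ B ] (ℚ.Positive B × ∃[ N ] (∀ n → N ℕ.≤ n → ℚ.∣ s n ∣ ℚ.≤ B))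
  cauchy-bounded s cs with cs 1ℚ (ℚₚ.positive⁻¹ 1ℚ)
  ... | N , p = 1ℚ ℚ.+ ℚ.∣ s N ∣ , B>0 , N , λ n N≤n → begin
    ℚ.∣ s n ∣
      ≡⟨ cong ℚ.∣_∣ (rearrange (s n) (s N)) ⟩
    ℚ.∣ (s n ℚ.- s N) ℚ.+ s N ∣
      ≤⟨ ℚₚ.∣p+q∣≤∣p∣+∣q∣ (s n ℚ.- s N) (s N) ⟩
    ℚ.∣ s n ℚ.- s N ∣ ℚ.+ ℚ.∣ s N ∣
      ≤⟨ ℚₚ.+-monoˡ-≤ ℚ.∣ s N ∣ (p n N N≤n ℕₚ.≤-refl) ⟩
    1ℚ ℚ.+ ℚ.∣ s N ∣ ∎
    where
    open ℚₚ.≤-Reasoning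
    rearrange : ∀ a b → a ≡ (a ℚ.- b) ℚ.+ b
    rearrange = solve-∀ ℚ-ring
    B>0 : ℚ.Positive (1ℚ ℚ.+ ℚ.∣ s N ∣)
    B>0 = ℚ.positive (ℚₚ.+-mono-<-≤ (ℚₚ.positive⁻¹ 1ℚ) (ℚₚ.0≤∣p∣ (s N)))

  -- A positive δ with B * δ ≡ ½ * ε.
  scale : ∀ B → ℚ.Positive B → ∀ {ε} → 0ℚ ℚ.< ε →
    ∃[ δ ] (0ℚ ℚ.< δ × B ℚ.* δ ≡ ½ ℚ.* ε)
  scale B B>0 {ε} 0<ε = 1/B ℚ.* (½ ℚ.* ε) , δ>0 , (begin
    B ℚ.* (1/B ℚ.* (½ ℚ.* ε)) ≡⟨ ℚₚ.*-assoc B 1/B (½ ℚ.* ε) ⟨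
    (B ℚ.* 1/B) ℚ.* (½ ℚ.* ε) ≡⟨ cong (ℚ._* (½ ℚ.* ε)) (ℚₚ.*-inverseʳ B) ⟩
    1ℚ ℚ.* (½ ℚ.* ε)          ≡⟨ ℚₚ.*-identityˡ (½ ℚ.* ε) ⟩
    ½ ℚ.* ε                   ∎)
    where
    open ≡-Reasoning
    instance
      posB : ℚ.Positive B
      posB = B>0
      nzB : ℚ.NonZero B
      nzB = ℚₚ.pos⇒nonZero B
    1/B : ℚ
    1/B = ℚ.1/ B
    δ>0 : 0ℚ ℚ.< 1/B ℚ.* (½ ℚ.* ε)
    δ>0 = subst (ℚ._< 1/B ℚ.* (½ ℚ.* ε)) (ℚₚ.*-zeroʳ 1/B)
            (ℚₚ.*-monoʳ-<-pos 1/B {{ℚₚ.1/pos⇒pos B}} (half>0 0<ε))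

  *-mono-∣∣ : ∀ p q {B δ} → ℚ.Positive B → ℚ.∣ p ∣ ℚ.≤ B → ℚ.∣ q ∣ ℚ.≤ δ →
    ℚ.∣ p ℚ.* q ∣ ℚ.≤ B ℚ.* δ
  *-mono-∣∣ p q {B} {δ} B>0 p≤B q≤δ = begin
    ℚ.∣ p ℚ.* q ∣
      ≡⟨ ℚₚ.∣p*q∣≡∣p∣*∣q∣ p q ⟩
    ℚ.∣ p ∣ ℚ.* ℚ.∣ q ∣
      ≤⟨ ℚₚ.*-monoʳ-≤-nonNeg ℚ.∣ q ∣ {{ℚₚ.∣-∣-nonNeg q}} p≤B ⟩
    B ℚ.* ℚ.∣ q ∣
      ≤⟨ ℚₚ.*-monoˡ-≤-nonNeg B {{ℚₚ.pos⇒nonNeg B {{B>0}}}} q≤δ ⟩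
    B ℚ.* δ ∎
    where open ℚₚ.≤-Reasoning

  *-diff : ∀ a b c d {A B δ ε} → ℚ.Positive A → ℚ.Positive B →
    ℚ.∣ a ∣ ℚ.≤ A → ℚ.∣ d ∣ ℚ.≤ B → ℚ.∣ a ℚ.- c ∣ ℚ.≤ δ → ℚ.∣ b ℚ.- d ∣ ℚ.≤ ε →
    ℚ.∣ a ℚ.* b ℚ.- c ℚ.* d ∣ ℚ.≤ B ℚ.* δ ℚ.+ A ℚ.* ε
  *-diff a b c d {A} {B} {δ} {ε} A>0 B>0 a≤A d≤B ac bd = begin
    ℚ.∣ a ℚ.* b ℚ.- c ℚ.* d ∣
      ≡⟨ cong ℚ.∣_∣ (rearrange a b c d) ⟩
    ℚ.∣ d ℚ.* (a ℚ.- c) ℚ.+ a ℚ.* (b ℚ.- d) ∣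
      ≤⟨ ℚₚ.∣p+q∣≤∣p∣+∣q∣ (d ℚ.* (a ℚ.- c)) (a ℚ.* (b ℚ.- d)) ⟩
    ℚ.∣ d ℚ.* (a ℚ.- c) ∣ ℚ.+ ℚ.∣ a ℚ.* (b ℚ.- d) ∣
      ≤⟨ ℚₚ.+-mono-≤ (*-mono-∣∣ d (a ℚ.- c) B>0 d≤B ac) (*-mono-∣∣ a (b ℚ.- d) A>0 a≤A bd) ⟩
    B ℚ.* δ ℚ.+ A ℚ.* ε ∎
    where
    open ℚₚ.≤-Reasoning
    rearrange : ∀ a b c d →
      a ℚ.* b ℚ.- c ℚ.* d ≡ d ℚ.* (a ℚ.- c) ℚ.+ a ℚ.* (b ℚ.- d)
    rearrange = solve-∀ ℚ-ring

  *-cauchy : ∀ s t → IsCauchy s → IsCauchy t → IsCauchy (λ n → s n ℚ.* t n)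
  *-cauchy s t cs ct ε 0<ε =
    let A , A>0 , N₁ , bs = cauchy-bounded s cs
        B , B>0 , N₂ , bt = cauchy-bounded t ct
        δₛ , δₛ>0 , Bδₛ   = scale B B>0 0<ε
        δₜ , δₜ>0 , Aδₜ   = scale A A>0 0<ε
        N₃ , ps           = cs δₛ δₛ>0
        N₄ , pt           = ct δₜ δₜ>0
        total : B ℚ.* δₛ ℚ.+ A ℚ.* δₜ ≡ ε
        total = trans (cong₂ ℚ._+_ Bδₛ Aδₜ) (half+half ε)
    in
    (N₁ ℕ.⊔ N₂) ℕ.⊔ (N₃ ℕ.⊔ N₄) , λ m n N≤m N≤n →
    let N₁₂≤m = ℕₚ.m⊔n≤o⇒m≤o (N₁ ℕ.⊔ N₂) (N₃ ℕ.⊔ N₄) N≤m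
        N₁₂≤n = ℕₚ.m⊔n≤o⇒m≤o (N₁ ℕ.⊔ N₂) (N₃ ℕ.⊔ N₄) N≤n
        N₃₄≤m = ℕₚ.m⊔n≤o⇒n≤o (N₁ ℕ.⊔ N₂) (N₃ ℕ.⊔ N₄) N≤m
        N₃₄≤n = ℕₚ.m⊔n≤o⇒n≤o (N₁ ℕ.⊔ N₂) (N₃ ℕ.⊔ N₄) N≤n
    in subst (ℚ.∣ s m ℚ.* t m ℚ.- s n ℚ.* t n ∣ ℚ.≤_) total
         (*-diff (s m) (t m) (s n) (t n) A>0 B>0
           (bs m (ℕₚ.m⊔n≤o⇒m≤o N₁ N₂ N₁₂≤m))
           (bt n (ℕₚ.m⊔n≤o⇒n≤o N₁ N₂ N₁₂≤n))
           (ps m n (ℕₚ.m⊔n≤o⇒m≤o N₃ N₄ N₃₄≤m) (ℕₚ.m⊔n≤o⇒m≤o N₃ N₄ N₃₄≤n))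
           (pt m n (ℕₚ.m⊔n≤o⇒n≤o N₃ N₄ N₃₄≤m) (ℕₚ.m⊔n≤o⇒n≤o N₃ N₄ N₃₄≤n)))

infixl 6 _+_
infixl 7 _*_

0ℝ : ℝ
0ℝ = fromℚ 0ℚ

_+_ : ℝ → ℝ → ℝ
x + y = mkℝ (λ n → seq x n ℚ.+ seq y n) (+-cauchy (seq x) (seq y) (cauchy x) (cauchy y))

_*_ : ℝ → ℝ → ℝ
x * y = mkℝ (λ n → seq x n ℚ.* seq y n) (*-cauchy (seq x) (seq y) (cauchy x) (cauchy y))

------------------------------------------------------------------------
-- Matrices and eigenvalues

∑ : ∀ {n} → (Fin n → ℝ) → ℝ
∑ = Vector.foldr _+_ 0ℝ

Matrix : ℕ → ℕ → Set
Matrix m n = Fin m → Fin n → ℝ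

infixl 7 _·_ _·ᵥ_
infix 8 _ᵀ

_ᵀ : ∀ {m n} → Matrix m n → Matrix n m
(A ᵀ) i j = A j i

_·_ : ∀ {m n p} → Matrix m n → Matrix n p → Matrix m p
(A · B) i k = ∑ λ j → A i j * B j k

_·ᵥ_ : ∀ {m n} → Matrix m n → (Fin n → ℝ) → (Fin m → ℝ)
(A ·ᵥ v) i = ∑ λ j → A i j * v j

IsEigenvalue : ∀ {n} → Matrix n n → ℝ → Set
IsEigenvalue A μ =
  ∃[ v ] (¬ (∀ i → v i ≈ 0ℝ) × (∀ i → (A ·ᵥ v) i ≈ μ * v i))

IsLargestEigenvalue : ∀ {n} → Matrix n n → ℝ → Set
IsLargestEigenvalue A μ = IsEigenvalue A μ × (∀ ν → IsEigenvalue A ν → ν ≤ μ)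

------------------------------------------------------------------------
-- Simplicial complexes on the vertex set Fin n, linearly ordered as usual

-- Decidability of membership makes the faces countable constructively;
-- classically it is no restriction.
record SimplicialComplex (n : ℕ) : Set₁ where
  field
    Face   : Pred (Subset n) 0ℓ
    Face?  : Decidable Face
    ⊥-face : Face ⊥
    closed : ∀ {σ τ} → σ ⊆ τ → Face τ → Face σ

dim : ∀ {n} → Subset n → ℤ
dim σ = + ∣ σ ∣ ℤ.- 1ℤ

HasDimension : ∀ {n} → SimplicialComplex n → ℤ → Set
HasDimension K d =
  (∃[ σ ] (Face σ × dim σ ≡ d)) × (∀ σ → Face σ → dim σ ℤ.≤ d)
  where open SimplicialComplex K

subsets : ∀ n → List (Subset n)
subsets zero    = [] ∷ []
subsets (suc n) = map (outside ∷_) (subsets n) ++ map (inside ∷_) (subsets n)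

module _ {n : ℕ} (K : SimplicialComplex n) where
  open SimplicialComplex K

  S : ℤ → List (Subset n)
  S i = filter (λ σ → Face? σ ×-dec (dim σ ℤₚ.≟ i)) (subsets n)

  f : ℤ → ℕ
  f i = length (S i)

_≟ₛ_ : ∀ {n} → DecidableEquality (Subset n)
_≟ₛ_ = ≡-dec Boolₚ._≟_

-- In increasing order, since allFin is.
vertices : ∀ {n} → Subset n → List (Fin n)
vertices {n} σ = filter (_∈? σ) (allFin n)

-- The coefficient of [σ] in ∑ⱼ (-1)ʲ [v₀,…,v̂ⱼ,…,vᵢ], where v₀ < … < vᵢ are
-- the vertices of τ.
∂-coefficient : ∀ {n} → Subset n → Subset n → ℝ
∂-coefficient σ τ = ∑ {length (vertices τ)} λ j →
  if does ((τ - lookup (vertices τ) j) ≟ₛ σ)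
  then fromℚ ((-1ℤ ℤ.^ toℕ j) ℚ./ 1)
  else 0ℝ

module _ {n : ℕ} (K : SimplicialComplex n) where

  B : (i : ℤ) → Matrix (f K (i ℤ.- 1ℤ)) (f K i)
  B i a b = ∂-coefficient (lookup (S K (i ℤ.- 1ℤ)) a) (lookup (S K i) b)

  Lᵘᵖ : (i : ℤ) → Matrix (f K (ℤ.suc i ℤ.- 1ℤ)) (f K (ℤ.suc i ℤ.- 1ℤ))
  Lᵘᵖ i = B (ℤ.suc i) · B (ℤ.suc i) ᵀ

{-# OPTIONS --safe #-}

-- Write ∂ for the matrix B_r. A nonzero eigenvalue of ∂∂ᵀ is one of ∂ᵀ∂, so it is
-- at most the largest absolute column sum of ∂ᵀ∂. That sum is at most r + f_r: the
-- diagonal entry is r + 1, and each of the other f_r - 1 entries is 0 or ±1, as two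
-- distinct r-faces share at most one (r-1)-face. Since K contains all the (r-2)-faces
-- of some r-simplex, f_{r-2}/r ≥ (r+1)/2, and
-- (r+1)/2 · f_r + (r+1)/2 - (r + f_r) = ((r+1)/2 - 1)(f_r - 1) ≥ 0.
module Submission where

open import Defs
open import Data.Nat.Base as ℕ using (ℕ; NonZero)
open import Data.Integer.Base as ℤ using (+_; 1ℤ)
open import Data.Rational.Base as ℚ using ()

open import Algebra.Bundles using (CommutativeRing)
open import Data.Bool.Base using (if_then_else_)
open import Data.Fin.Base using (Fin; zero; suc; toℕ)
open import Data.Fin.Properties using (any?; suc-injective) renaming (_≟_ to _≟ᶠ_)
open import Data.Fin.Subset using (Subset; inside; outside; _∈_; _∉_; _⊆_; _-_; ∣_∣)
open import Data.Fin.Subset.Properties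
  using (_∈?_; ⊆-antisym; x∈p∧x≢y⇒x∈p-y; x∈p⇒p-x⊂p; p─q⊆p; drop-there; out⊆; in⊆in)
open import Data.Integer.Base using (ℤ; -1ℤ)
open import Data.Integer.Properties as ℤₚ using ()
open import Data.Integer.Tactic.RingSolver using () renaming (solve-∀ to solveℤ-∀)
open import Data.List.Base using (List; []; _∷_; _++_; map; filter; length; lookup; allFin; tabulate)
open import Data.List.Membership.Propositional.Properties using (∈-lookup; ∈-filter⁻; ∈-map⁻)
open import Data.List.Properties using (filter-++; length-++)
open import Data.List.Relation.Binary.Disjoint.Propositional using (Disjoint)
open import Data.List.Relation.Unary.All as All using ([]; _∷_)
open import Data.List.Relation.Unary.AllPairs using ([]; _∷_)
open import Data.List.Relation.Unary.Unique.Propositional using (Unique)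
open import Data.List.Relation.Unary.Unique.Propositional.Properties using (map⁺; ++⁺; filter⁺; allFin⁺)
open import Data.Nat.Combinatorics using (_C_; nC1≡n; nCk+nC[k+1]≡[n+1]C[k+1])
open import Data.Nat.Properties as ℕₚ using ()
open import Data.Product.Base using (_,_; _×_; ∃-syntax; proj₁; proj₂)
open import Data.Rational.Base using (ℚ; 0ℚ; 1ℚ; ½)
open import Data.Rational.Properties as ℚₚ using ()
import Data.Rational.Unnormalised.Base as ℚᵘ
import Data.Rational.Unnormalised.Properties as ℚᵘₚ
open import Data.Sum.Base using (_⊎_; inj₁; inj₂; [_,_]′)
open import Data.Vec.Base using ([]; _∷_)
open import Data.Vec.Properties using () renaming (∷-injectiveʳ to ∷ᵛ-injectiveʳ)
open import Function.Base using (_∘_; id)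
open import Level using (0ℓ)
open import Relation.Binary.PropositionalEquality
  using (_≡_; _≢_; refl; sym; trans; cong; cong₂; subst; module ≡-Reasoning)
open import Relation.Nullary.Decidable using (Dec; yes; no; does; ¬?; _×-dec_; dec⇒maybe; decidable-stable)
open import Relation.Nullary.Negation using (¬_; contradiction)
open import Relation.Unary using (Pred; Decidable)
open import Tactic.RingSolver using (solve-∀)
open import Tactic.RingSolver.Core.AlmostCommutativeRing
  using (AlmostCommutativeRing; fromCommutativeRing)
open import Algebra.Properties.AbelianGroup ℤₚ.+-0-abelianGroup using () renaming (∙-cancelʳ to +-cancelʳ)
open import Algebra.Properties.Semiring.Sum (CommutativeRing.semiring ℚₚ.+-*-commutativeRing)
  using (sum; sum-cong-≗; sum-replicate-zero; ∑-distrib-+; ∑-comm; *-distribˡ-sum; *-distribʳ-sum)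

-- Sums of rationals

-- An eigenvector over Cauchy sequences is only known not to vanish identically: no coordinate
-- bounded away from zero is at hand, and whether an eigenvalue is zero cannot be decided. The
-- estimate is therefore a perturbation bound at each index of the sequences, where all matrices are
-- rational and `∂∂ᵀ v = l v` holds up to an error `η`. If `l` stays above `c + γ`, the vector
-- `w = ∂ᵀ v` has 1-norm of order `η / γ`, and since `c` is at least 1 the equation
-- `l v = ∂ w + error` makes `v` comparably small. As `η` is arbitrary, `v` would vanish; so `l`
-- cannot exceed `c`, and `l ≤ c` follows from the refuted strict inequality. The 1-norm is what
-- pairs with column sums, and it avoids choosing a coordinate of largest modulus. For `c` the
-- right-hand side of the theorem itself is taken, so that the comparison with `r + f_r` remains
-- among rationals.

ℚ-ring : AlmostCommutativeRing 0ℓ 0ℓ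
ℚ-ring = fromCommutativeRing ℚₚ.+-*-commutativeRing λ p → dec⇒maybe (0ℚ ℚₚ.≟ p)

sum-mono-≤ : ∀ {n} {f g : Fin n → ℚ} → (∀ i → f i ℚ.≤ g i) → sum f ℚ.≤ sum g
sum-mono-≤ {ℕ.zero}  f≤g = ℚₚ.≤-refl
sum-mono-≤ {ℕ.suc _} f≤g = ℚₚ.+-mono-≤ (f≤g zero) (sum-mono-≤ (f≤g ∘ suc))

∣sum∣≤sum∣∣ : ∀ {n} (f : Fin n → ℚ) → ℚ.∣ sum f ∣ ℚ.≤ sum (ℚ.∣_∣ ∘ f)
∣sum∣≤sum∣∣ {ℕ.zero}  f = ℚₚ.≤-refl
∣sum∣≤sum∣∣ {ℕ.suc _} f = ℚₚ.≤-trans (ℚₚ.∣p+q∣≤∣p∣+∣q∣ (f zero) _)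
  (ℚₚ.+-monoʳ-≤ ℚ.∣ f zero ∣ (∣sum∣≤sum∣∣ (f ∘ suc)))

-- Allowing `a + b` rather than `a` at `j` lets the constant sum run over all indices, with no
-- `n - 1`. On a column of ∂ᵀ∂ the diagonal `r + 1` is split as `a = r` and `b = 1`.
sum-exceptional : ∀ {n} (f : Fin n → ℚ) (j : Fin n) {a b} → f j ℚ.≤ a ℚ.+ b →
  (∀ i → i ≢ j → f i ℚ.≤ b) → sum f ℚ.≤ a ℚ.+ sum {n} (λ _ → b)
sum-exceptional f zero {a} {b} fj≤ f≤ = ℚₚ.≤-trans
  (ℚₚ.+-mono-≤ fj≤ (sum-mono-≤ λ i → f≤ (suc i) λ ()))
  (ℚₚ.≤-reflexive (ℚₚ.+-assoc a b _))
sum-exceptional f (suc j) {a} {b} fj≤ f≤ = ℚₚ.≤-trans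
  (ℚₚ.+-mono-≤ (f≤ zero λ ())
    (sum-exceptional (f ∘ suc) j {a} fj≤ λ i i≢j → f≤ (suc i) (i≢j ∘ suc-injective)))
  (ℚₚ.≤-reflexive (swap b a _))
  where
  swap : ∀ x y z → x ℚ.+ (y ℚ.+ z) ≡ y ℚ.+ (x ℚ.+ z)
  swap = solve-∀ ℚ-ring

-- Serves three kinds of uniqueness: a facet determines the position of the removed vertex, a set
-- determines its index in a list without repetitions, and two distinct simplices determine their
-- common facet.
sum-atMostOne : ∀ {n} (f : Fin n → ℚ) {a} → 0ℚ ℚ.≤ a → (∀ i → f i ℚ.≤ a) →
  (∀ i j → f i ≢ 0ℚ → f j ≢ 0ℚ → i ≡ j) → sum f ℚ.≤ a
sum-atMostOne {n} f {a} 0≤a f≤a unique with any? (λ j → ¬? (f j ℚₚ.≟ 0ℚ))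
... | yes (j , fj≢0) = begin
  sum f                       ≤⟨ sum-exceptional f j {a} (subst (f j ℚ.≤_) (sym (ℚₚ.+-identityʳ a)) (f≤a j)) off ⟩
  a ℚ.+ sum {n} (λ _ → 0ℚ)    ≡⟨ cong (a ℚ.+_) (sum-replicate-zero n) ⟩
  a ℚ.+ 0ℚ                    ≡⟨ ℚₚ.+-identityʳ a ⟩
  a                           ∎
  where
  open ℚₚ.≤-Reasoning
  off : ∀ i → i ≢ j → f i ℚ.≤ 0ℚ
  off i i≢j = ℚₚ.≤-reflexive (decidable-stable (f i ℚₚ.≟ 0ℚ) λ fi≢0 → i≢j (unique i j fi≢0 fj≢0))
... | no none = begin
  sum f              ≤⟨ sum-mono-≤ (λ i → ℚₚ.≤-reflexive (decidable-stable (f i ℚₚ.≟ 0ℚ) λ fi≢0 → none (i , fi≢0))) ⟩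
  sum {n} (λ _ → 0ℚ) ≡⟨ sum-replicate-zero n ⟩
  0ℚ                 ≤⟨ 0≤a ⟩
  a                  ∎
  where open ℚₚ.≤-Reasoning

-- Associativity of row times matrix times column. It gives both `(BBᵀ)v = B(Bᵀv)` and
-- `(BᵀB)w = Bᵀ(Bw)`.
sum-*-assoc : ∀ {m p} (x : Fin p → ℚ) (Y : Fin p → Fin m → ℚ) (z : Fin m → ℚ) →
  sum (λ k → sum (λ j → x j ℚ.* Y j k) ℚ.* z k) ≡ sum (λ j → x j ℚ.* sum (λ k → Y j k ℚ.* z k))
sum-*-assoc x Y z = begin
  sum (λ k → sum (λ j → x j ℚ.* Y j k) ℚ.* z k)
    ≡⟨ sum-cong-≗ (λ k → *-distribʳ-sum (z k) λ j → x j ℚ.* Y j k) ⟩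
  sum (λ k → sum (λ j → x j ℚ.* Y j k ℚ.* z k))
    ≡⟨ ∑-comm (λ k j → x j ℚ.* Y j k ℚ.* z k) ⟩
  sum (λ j → sum (λ k → x j ℚ.* Y j k ℚ.* z k))
    ≡⟨ sum-cong-≗ (λ j → trans (sum-cong-≗ λ k → ℚₚ.*-assoc (x j) (Y j k) (z k))
         (sym (*-distribˡ-sum (x j) λ k → Y j k ℚ.* z k))) ⟩
  sum (λ j → x j ℚ.* sum (λ k → Y j k ℚ.* z k)) ∎
  where open ≡-Reasoning

∣p*q∣≤∣q∣ : ∀ p q → ℚ.∣ p ∣ ℚ.≤ 1ℚ → ℚ.∣ p ℚ.* q ∣ ℚ.≤ ℚ.∣ q ∣
∣p*q∣≤∣q∣ p q p≤1 = begin
  ℚ.∣ p ℚ.* q ∣        ≡⟨ ℚₚ.∣p*q∣≡∣p∣*∣q∣ p q ⟩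
  ℚ.∣ p ∣ ℚ.* ℚ.∣ q ∣  ≤⟨ ℚₚ.*-monoʳ-≤-nonNeg ℚ.∣ q ∣ {{ℚₚ.∣-∣-nonNeg q}} p≤1 ⟩
  1ℚ ℚ.* ℚ.∣ q ∣       ≡⟨ ℚₚ.*-identityˡ _ ⟩
  ℚ.∣ q ∣              ∎
  where open ℚₚ.≤-Reasoning

sum-nonNeg : ∀ {n} {f : Fin n → ℚ} → (∀ i → 0ℚ ℚ.≤ f i) → 0ℚ ℚ.≤ sum f
sum-nonNeg {n} 0≤f = ℚₚ.≤-trans (ℚₚ.≤-reflexive (sym (sum-replicate-zero n))) (sum-mono-≤ 0≤f)

-- The number m p, as the double sum in which it arises.
area : ℕ → ℕ → ℚ
area m p = sum {p} λ _ → sum {m} λ _ → 1ℚ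

-- Bounds w = Bᵀv in the 1-norm: l w is BᵀB w up to an error of size η per row of B.
approximate-eigenvector-small : ∀ {m p} (B : Fin m → Fin p → ℚ) →
  (∀ i j → ℚ.∣ B i j ∣ ℚ.≤ 1ℚ) →
  ∀ {c} → (∀ k → sum (λ j → ℚ.∣ sum (λ i → B i j ℚ.* B i k) ∣) ℚ.≤ c) →
  ∀ {γ η} l (v : Fin m → ℚ) → 0ℚ ℚ.≤ γ → 1ℚ ℚ.≤ l → c ℚ.+ γ ℚ.≤ l →
  (∀ i → ℚ.∣ sum (λ k → sum (λ j → B i j ℚ.* B k j) ℚ.* v k) ℚ.- l ℚ.* v i ∣ ℚ.≤ η) →
  ∀ i → γ ℚ.* ℚ.∣ v i ∣ ℚ.≤ (area m p ℚ.+ γ) ℚ.* η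
approximate-eigenvector-small {m} {p} B ∣B∣≤1 {c} columns {γ} {η} l v 0≤γ 1≤l c+γ≤l near i = begin
  γ ℚ.* ℚ.∣ v i ∣                      ≤⟨ ℚₚ.*-monoˡ-≤-nonNeg γ ∣v∣≤ ⟩
  γ ℚ.* (‖w‖ ℚ.+ η)                    ≡⟨ ℚₚ.*-distribˡ-+ γ ‖w‖ η ⟩
  γ ℚ.* ‖w‖ ℚ.+ γ ℚ.* η                ≤⟨ ℚₚ.+-monoˡ-≤ (γ ℚ.* η) γ‖w‖≤ ⟩
  area m p ℚ.* η ℚ.+ γ ℚ.* η           ≡⟨ ℚₚ.*-distribʳ-+ η (area m p) γ ⟨
  (area m p ℚ.+ γ) ℚ.* η               ∎
  where
  open ℚₚ.≤-Reasoning
  instance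
    γ≥0 : ℚ.NonNegative γ
    γ≥0 = ℚ.nonNegative 0≤γ
  0≤l : 0ℚ ℚ.≤ l
  0≤l = ℚₚ.≤-trans (ℚₚ.nonNegative⁻¹ 1ℚ) 1≤l
  w : Fin p → ℚ
  w j = sum λ k → B k j ℚ.* v k
  ‖w‖ : ℚ
  ‖w‖ = sum λ j → ℚ.∣ w j ∣
  u d : Fin m → ℚ
  u i = sum λ j → B i j ℚ.* w j
  d i = l ℚ.* v i ℚ.- u i
  ∣d∣≤η : ∀ i → ℚ.∣ d i ∣ ℚ.≤ η
  ∣d∣≤η i = begin
    ℚ.∣ l ℚ.* v i ℚ.- u i ∣           ≡⟨ ℚₚ.∣-p∣≡∣p∣ (d i) ⟨
    ℚ.∣ ℚ.- (l ℚ.* v i ℚ.- u i) ∣     ≡⟨ cong ℚ.∣_∣ (flip (l ℚ.* v i) (u i)) ⟩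
    ℚ.∣ u i ℚ.- l ℚ.* v i ∣           ≡⟨ cong (λ t → ℚ.∣ t ℚ.- l ℚ.* v i ∣) (sum-*-assoc (B i) (λ j k → B k j) v) ⟨
    ℚ.∣ sum (λ k → sum (λ j → B i j ℚ.* B k j) ℚ.* v k) ℚ.- l ℚ.* v i ∣ ≤⟨ near i ⟩
    η ∎
    where
    flip : ∀ x y → ℚ.- (x ℚ.- y) ≡ y ℚ.- x
    flip = solve-∀ ℚ-ring
  M : Fin p → Fin p → ℚ
  M j k = sum λ i → B i j ℚ.* B i k
  lv : ∀ i → l ℚ.* v i ≡ u i ℚ.+ d i
  lv i = split (l ℚ.* v i) (u i)
    where
    split : ∀ x y → x ≡ y ℚ.+ (x ℚ.- y)
    split = solve-∀ ℚ-ring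
  -- Applying Bᵀ to `l v = B w + d` turns the approximate eigenvector `v` of BBᵀ into the
  -- approximate eigenvector `w` of `M = BᵀB`, with error Bᵀd.
  lw : ∀ j → l ℚ.* w j ≡ sum (λ k → M j k ℚ.* w k) ℚ.+ sum (λ i → B i j ℚ.* d i)
  lw j = begin-equality
    l ℚ.* w j
      ≡⟨ *-distribˡ-sum l (λ k → B k j ℚ.* v k) ⟩
    sum (λ i → l ℚ.* (B i j ℚ.* v i))
      ≡⟨ sum-cong-≗ (λ i → trans (swap l (B i j) (v i))
           (trans (cong (B i j ℚ.*_) (lv i)) (ℚₚ.*-distribˡ-+ (B i j) (u i) (d i)))) ⟩
    sum (λ i → B i j ℚ.* u i ℚ.+ B i j ℚ.* d i)
      ≡⟨ ∑-distrib-+ (λ i → B i j ℚ.* u i) (λ i → B i j ℚ.* d i) ⟩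
    sum (λ i → B i j ℚ.* u i) ℚ.+ sum (λ i → B i j ℚ.* d i)
      ≡⟨ cong (ℚ._+ sum (λ i → B i j ℚ.* d i)) (sum-*-assoc (λ i → B i j) B w) ⟨
    sum (λ k → M j k ℚ.* w k) ℚ.+ sum (λ i → B i j ℚ.* d i) ∎
    where
    swap : ∀ x y z → x ℚ.* (y ℚ.* z) ≡ y ℚ.* (x ℚ.* z)
    swap = solve-∀ ℚ-ring
  l∣w∣≤ : ∀ j → l ℚ.* ℚ.∣ w j ∣ ℚ.≤ sum (λ k → ℚ.∣ M j k ∣ ℚ.* ℚ.∣ w k ∣) ℚ.+ sum {m} (λ _ → η)
  l∣w∣≤ j = begin
    l ℚ.* ℚ.∣ w j ∣
      ≡⟨ cong (ℚ._* ℚ.∣ w j ∣) (ℚₚ.0≤p⇒∣p∣≡p 0≤l) ⟨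
    ℚ.∣ l ∣ ℚ.* ℚ.∣ w j ∣
      ≡⟨ ℚₚ.∣p*q∣≡∣p∣*∣q∣ l (w j) ⟨
    ℚ.∣ l ℚ.* w j ∣
      ≡⟨ cong ℚ.∣_∣ (lw j) ⟩
    ℚ.∣ sum (λ k → M j k ℚ.* w k) ℚ.+ sum (λ i → B i j ℚ.* d i) ∣
      ≤⟨ ℚₚ.∣p+q∣≤∣p∣+∣q∣ (sum (λ k → M j k ℚ.* w k)) (sum (λ i → B i j ℚ.* d i)) ⟩
    ℚ.∣ sum (λ k → M j k ℚ.* w k) ∣ ℚ.+ ℚ.∣ sum (λ i → B i j ℚ.* d i) ∣
      ≤⟨ ℚₚ.+-mono-≤
           (ℚₚ.≤-trans (∣sum∣≤sum∣∣ λ k → M j k ℚ.* w k)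
             (ℚₚ.≤-reflexive (sum-cong-≗ λ k → ℚₚ.∣p*q∣≡∣p∣*∣q∣ (M j k) (w k))))
           (ℚₚ.≤-trans (∣sum∣≤sum∣∣ λ i → B i j ℚ.* d i)
             (sum-mono-≤ λ i → ℚₚ.≤-trans (∣p*q∣≤∣q∣ (B i j) (d i) (∣B∣≤1 i j)) (∣d∣≤η i))) ⟩
    sum (λ k → ℚ.∣ M j k ∣ ℚ.* ℚ.∣ w k ∣) ℚ.+ sum {m} (λ _ → η) ∎
  const-sum : ∀ n → sum {n} (λ _ → η) ≡ sum {n} (λ _ → 1ℚ) ℚ.* η
  const-sum n = trans (sum-cong-≗ {n} λ _ → sym (ℚₚ.*-identityˡ η)) (sym (*-distribʳ-sum {n} η λ _ → 1ℚ))
  l‖w‖≤ : l ℚ.* ‖w‖ ℚ.≤ c ℚ.* ‖w‖ ℚ.+ area m p ℚ.* η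
  l‖w‖≤ = begin
    l ℚ.* ‖w‖
      ≡⟨ *-distribˡ-sum l (λ j → ℚ.∣ w j ∣) ⟩
    sum (λ j → l ℚ.* ℚ.∣ w j ∣)
      ≤⟨ sum-mono-≤ l∣w∣≤ ⟩
    sum (λ j → sum (λ k → ℚ.∣ M j k ∣ ℚ.* ℚ.∣ w k ∣) ℚ.+ sum {m} (λ _ → η))
      ≡⟨ ∑-distrib-+ (λ j → sum (λ k → ℚ.∣ M j k ∣ ℚ.* ℚ.∣ w k ∣)) (λ _ → sum {m} (λ _ → η)) ⟩
    sum (λ j → sum (λ k → ℚ.∣ M j k ∣ ℚ.* ℚ.∣ w k ∣)) ℚ.+ sum {p} (λ _ → sum {m} (λ _ → η))
      -- Exchanging the sums makes a column sum of `|M|` the factor of `|w k|`; the errors add up to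
      -- the number of entries of `B` times `η`.
      ≡⟨ cong₂ ℚ._+_
           (trans (∑-comm λ j k → ℚ.∣ M j k ∣ ℚ.* ℚ.∣ w k ∣)
             (sum-cong-≗ λ k → sym (*-distribʳ-sum ℚ.∣ w k ∣ λ j → ℚ.∣ M j k ∣)))
           (trans (sum-cong-≗ {p} λ _ → const-sum m) (sym (*-distribʳ-sum {p} η λ _ → sum {m} λ _ → 1ℚ))) ⟩
    sum (λ k → sum (λ j → ℚ.∣ M j k ∣) ℚ.* ℚ.∣ w k ∣) ℚ.+ area m p ℚ.* η
      ≤⟨ ℚₚ.+-monoˡ-≤ (area m p ℚ.* η) (sum-mono-≤ λ k →
           ℚₚ.*-monoʳ-≤-nonNeg ℚ.∣ w k ∣ {{ℚₚ.∣-∣-nonNeg (w k)}} (columns k)) ⟩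
    sum (λ k → c ℚ.* ℚ.∣ w k ∣) ℚ.+ area m p ℚ.* η
      ≡⟨ cong (ℚ._+ area m p ℚ.* η) (*-distribˡ-sum c λ k → ℚ.∣ w k ∣) ⟨
    c ℚ.* ‖w‖ ℚ.+ area m p ℚ.* η ∎
  0≤‖w‖ : 0ℚ ℚ.≤ ‖w‖
  0≤‖w‖ = sum-nonNeg λ j → ℚₚ.0≤∣p∣ (w j)
  γ‖w‖≤ : γ ℚ.* ‖w‖ ℚ.≤ area m p ℚ.* η
  γ‖w‖≤ = begin
    γ ℚ.* ‖w‖
      ≡⟨ shift c γ ‖w‖ ⟩
    ℚ.- (c ℚ.* ‖w‖) ℚ.+ (c ℚ.+ γ) ℚ.* ‖w‖
      ≤⟨ ℚₚ.+-monoʳ-≤ (ℚ.- (c ℚ.* ‖w‖)) (ℚₚ.≤-trans (ℚₚ.*-monoʳ-≤-nonNeg ‖w‖ {{ℚ.nonNegative 0≤‖w‖}} c+γ≤l) l‖w‖≤) ⟩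
    ℚ.- (c ℚ.* ‖w‖) ℚ.+ (c ℚ.* ‖w‖ ℚ.+ area m p ℚ.* η)
      ≡⟨ cancel (c ℚ.* ‖w‖) (area m p ℚ.* η) ⟩
    area m p ℚ.* η ∎
    where
    shift : ∀ x y z → y ℚ.* z ≡ ℚ.- (x ℚ.* z) ℚ.+ (x ℚ.+ y) ℚ.* z
    shift = solve-∀ ℚ-ring
    cancel : ∀ x y → ℚ.- x ℚ.+ (x ℚ.+ y) ≡ y
    cancel = solve-∀ ℚ-ring
  -- `1 ≤ l` recovers `v` from `l v = B w + d` without a division; it stands in for the eigenvalue
  -- being nonzero.
  ∣v∣≤ : ℚ.∣ v i ∣ ℚ.≤ ‖w‖ ℚ.+ η
  ∣v∣≤ = begin
    ℚ.∣ v i ∣                    ≡⟨ ℚₚ.*-identityˡ _ ⟨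
    1ℚ ℚ.* ℚ.∣ v i ∣             ≤⟨ ℚₚ.*-monoʳ-≤-nonNeg ℚ.∣ v i ∣ {{ℚₚ.∣-∣-nonNeg (v i)}} 1≤l ⟩
    l ℚ.* ℚ.∣ v i ∣              ≡⟨ cong (ℚ._* ℚ.∣ v i ∣) (ℚₚ.0≤p⇒∣p∣≡p 0≤l) ⟨
    ℚ.∣ l ∣ ℚ.* ℚ.∣ v i ∣        ≡⟨ ℚₚ.∣p*q∣≡∣p∣*∣q∣ l (v i) ⟨
    ℚ.∣ l ℚ.* v i ∣              ≡⟨ cong ℚ.∣_∣ (lv i) ⟩
    ℚ.∣ u i ℚ.+ d i ∣            ≤⟨ ℚₚ.∣p+q∣≤∣p∣+∣q∣ (u i) (d i) ⟩
    ℚ.∣ u i ∣ ℚ.+ ℚ.∣ d i ∣      ≤⟨ ℚₚ.+-mono-≤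
                                      (ℚₚ.≤-trans (∣sum∣≤sum∣∣ λ j → B i j ℚ.* w j)
                                        (sum-mono-≤ λ j → ∣p*q∣≤∣q∣ (B i j) (w j) (∣B∣≤1 i j)))
                                      (∣d∣≤η i) ⟩
    ‖w‖ ℚ.+ η                    ∎

-- Eigenvalues of Gram matrices

seq-∑ : ∀ {n} (x : Fin n → ℝ) N → seq (∑ x) N ≡ sum (λ i → seq (x i) N)
seq-∑ {ℕ.zero}  x N = refl
seq-∑ {ℕ.suc _} x N = cong (seq (x zero) N ℚ.+_) (seq-∑ (x ∘ suc) N)

seq-∑-* : ∀ {n} (x y : Fin n → ℝ) N →
  seq (∑ λ i → x i * y i) N ≡ sum (λ i → seq (x i) N ℚ.* seq (y i) N)
seq-∑-* x y N = seq-∑ (λ i → x i * y i) N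

seq-·ᵥ : ∀ {m p} (A : Matrix m p) v n i → seq ((A ·ᵥ v) i) n ≡ sum (λ k → seq (A i k) n ℚ.* seq (v k) n)
seq-·ᵥ A v n i = seq-∑-* (A i) v n

seq-· : ∀ {m p q} (A : Matrix m p) (C : Matrix p q) n i k →
  seq ((A · C) i k) n ≡ sum (λ j → seq (A i j) n ℚ.* seq (C j k) n)
seq-· A C n i k = seq-∑-* (A i) (λ j → C j k) n

seq-gram : ∀ {m p} (B : Matrix m p) v n i → seq (((B · B ᵀ) ·ᵥ v) i) n ≡
    sum (λ k → sum (λ j → seq (B i j) n ℚ.* seq (B k j) n) ℚ.* seq (v k) n)
seq-gram B v n i = trans (seq-·ᵥ (B · B ᵀ) v n i)
  (sum-cong-≗ λ k → cong (ℚ._* seq (v k) n) (seq-· B (B ᵀ) n i k))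

eventually-all : ∀ {m} {P : Fin m → ℕ → Set} →
  (∀ i → ∃[ N ] (∀ n → N ℕ.≤ n → P i n)) → ∃[ N ] (∀ n → N ℕ.≤ n → ∀ i → P i n)
eventually-all {ℕ.zero}  ev = 0 , λ _ _ ()
eventually-all {ℕ.suc m} ev with ev zero | eventually-all (ev ∘ suc)
... | N₁ , p₁ | N₂ , p₂ = N₁ ℕ.⊔ N₂ , λ where
  n N≤n zero    → p₁ n (ℕₚ.m⊔n≤o⇒m≤o N₁ N₂ N≤n)
  n N≤n (suc i) → p₂ n (ℕₚ.m⊔n≤o⇒n≤o N₁ N₂ N≤n) i

p≤q+∣p-q∣ : ∀ p q → p ℚ.≤ q ℚ.+ ℚ.∣ p ℚ.- q ∣
p≤q+∣p-q∣ p q = begin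
  p                          ≡⟨ split p q ⟩
  q ℚ.+ (p ℚ.- q)            ≤⟨ ℚₚ.+-monoʳ-≤ q (p≤∣p∣ (p ℚ.- q)) ⟩
  q ℚ.+ ℚ.∣ p ℚ.- q ∣        ∎
  where
  open ℚₚ.≤-Reasoning
  split : ∀ p q → p ≡ q ℚ.+ (p ℚ.- q)
  split = solve-∀ ℚ-ring
  p≤∣p∣ : ∀ p → p ℚ.≤ ℚ.∣ p ∣
  p≤∣p∣ p with ℚₚ.≤-total 0ℚ p
  ... | inj₁ 0≤p = ℚₚ.≤-reflexive (sym (ℚₚ.0≤p⇒∣p∣≡p 0≤p))
  ... | inj₂ p≤0 = ℚₚ.≤-trans p≤0 (ℚₚ.0≤∣p∣ p)

-- Comparing one late term with q + 2γ is decidable, so non-strict inequality is ¬¬-stable.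
≮⇒≤ : ∀ x q →
  ¬ (∃[ γ ] (0ℚ ℚ.< γ × ∃[ N ] (∀ n → N ℕ.≤ n → q ℚ.+ γ ℚ.≤ seq x n))) → x ≤ fromℚ q
≮⇒≤ x q q≮x ε 0<ε = main (½ ℚ.* (½ ℚ.* ε)) (ℚₚ.*-monoʳ-<-pos ½ (ℚₚ.*-monoʳ-<-pos ½ 0<ε)) (quarters q ε)
  where
  open ℚₚ.≤-Reasoning
  quarters : ∀ z y →
    z ℚ.+ ½ ℚ.* (½ ℚ.* y) ℚ.+ ½ ℚ.* (½ ℚ.* y) ℚ.+ ½ ℚ.* (½ ℚ.* y) ℚ.+ ½ ℚ.* (½ ℚ.* y) ≡ z ℚ.+ y
  quarters = solve-∀ ℚ-ring
  add-sub : ∀ y z → y ℚ.+ z ℚ.- z ≡ y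
  add-sub = solve-∀ ℚ-ring
  -- Here `γ` is a quarter of `ε`. A late term at most `q + 2γ` keeps all later ones below `q + 3γ`;
  -- otherwise later ones stay above `q + γ`, which is excluded.
  main : ∀ γ → 0ℚ ℚ.< γ → q ℚ.+ γ ℚ.+ γ ℚ.+ γ ℚ.+ γ ≡ q ℚ.+ ε →
    ∃[ N ] (∀ n → N ℕ.≤ n → seq x n ℚ.≤ q ℚ.+ ε)
  main γ 0<γ 4γ≡ε with cauchy x γ 0<γ
  ... | N , close = N , compare (seq x N ℚₚ.≤? q ℚ.+ γ ℚ.+ γ)
    where
    near : ∀ a b → N ℕ.≤ a → N ℕ.≤ b → seq x a ℚ.≤ seq x b ℚ.+ γ
    near a b N≤a N≤b = ℚₚ.≤-trans (p≤q+∣p-q∣ (seq x a) (seq x b))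
      (ℚₚ.+-monoʳ-≤ (seq x b) (close a b N≤a N≤b))
    compare : Dec (seq x N ℚ.≤ q ℚ.+ γ ℚ.+ γ) → ∀ n → N ℕ.≤ n → seq x n ℚ.≤ q ℚ.+ ε
    compare (yes x≤) n N≤n = begin
      seq x n                     ≤⟨ near n N N≤n ℕₚ.≤-refl ⟩
      seq x N ℚ.+ γ               ≤⟨ ℚₚ.+-monoˡ-≤ γ x≤ ⟩
      q ℚ.+ γ ℚ.+ γ ℚ.+ γ         ≡⟨ ℚₚ.+-identityʳ (q ℚ.+ γ ℚ.+ γ ℚ.+ γ) ⟨
      q ℚ.+ γ ℚ.+ γ ℚ.+ γ ℚ.+ 0ℚ  ≤⟨ ℚₚ.+-monoʳ-≤ (q ℚ.+ γ ℚ.+ γ ℚ.+ γ) (ℚₚ.<⇒≤ 0<γ) ⟩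
      q ℚ.+ γ ℚ.+ γ ℚ.+ γ ℚ.+ γ   ≡⟨ 4γ≡ε ⟩
      q ℚ.+ ε                     ∎
    compare (no x≰) _ _ = contradiction (γ , 0<γ , N , λ n N≤n → begin
      q ℚ.+ γ                     ≡⟨ add-sub (q ℚ.+ γ) γ ⟨
      q ℚ.+ γ ℚ.+ γ ℚ.- γ         ≤⟨ ℚₚ.+-monoˡ-≤ (ℚ.- γ) (ℚₚ.<⇒≤ (ℚₚ.≰⇒> x≰)) ⟩
      seq x N ℚ.- γ               ≤⟨ ℚₚ.+-monoˡ-≤ (ℚ.- γ) (near N n ℕₚ.≤-refl N≤n) ⟩
      seq x n ℚ.+ γ ℚ.- γ         ≡⟨ add-sub (seq x n) γ ⟩
      seq x n                     ∎) q≮x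

module _ {m p} (B : Matrix m p) {c : ℚ} (1≤c : 1ℚ ℚ.≤ c)
  (∣B∣≤1 : ∀ N i j → ℚ.∣ seq (B i j) N ∣ ℚ.≤ 1ℚ)
  (columns : ∀ N k → sum (λ j → ℚ.∣ sum (λ i → seq (B i j) N ℚ.* seq (B i k) N) ∣) ℚ.≤ c)
  where

  -- The perturbation bound holds for every error `η`, and the equation `eigen` makes `η` as small
  -- as desired at late indices, for all coordinates at once.
  eigenvector-null : ∀ l v {γ N₀} → 0ℚ ℚ.< γ → (∀ n → N₀ ℕ.≤ n → c ℚ.+ γ ℚ.≤ seq l n) →
    (∀ i → ((B · B ᵀ) ·ᵥ v) i ≈ l * v i) → ∀ i → v i ≈ 0ℝ
  eigenvector-null l v {γ} {N₀} 0<γ c+γ≤l eigen i δ 0<δ = choose K 0<K refl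
    where
    open ℚₚ.≤-Reasoning
    K : ℚ
    K = area m p ℚ.+ γ
    0<K : 0ℚ ℚ.< K
    0<K = ℚₚ.+-mono-≤-< (sum-nonNeg {p} λ _ → sum-nonNeg {m} λ _ → ℚₚ.nonNegative⁻¹ 1ℚ) 0<γ
    1≤l : ∀ {x} → c ℚ.+ γ ℚ.≤ x → 1ℚ ℚ.≤ x
    1≤l {x} c+γ≤x = begin
      1ℚ       ≤⟨ 1≤c ⟩
      c        ≡⟨ ℚₚ.+-identityʳ c ⟨
      c ℚ.+ 0ℚ ≤⟨ ℚₚ.+-monoʳ-≤ c (ℚₚ.<⇒≤ 0<γ) ⟩
      c ℚ.+ γ  ≤⟨ c+γ≤x ⟩
      x        ∎
    instance
      γ-pos : ℚ.Positive γ
      γ-pos = ℚ.positive 0<γ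
      δ-pos : ℚ.Positive δ
      δ-pos = ℚ.positive 0<δ
      γδ-pos : ℚ.Positive (γ ℚ.* δ)
      γδ-pos = ℚₚ.pos*pos⇒pos γ δ
    choose : ∀ k → 0ℚ ℚ.< k → K ≡ k → ∃[ N ] (∀ n → N ℕ.≤ n → ℚ.∣ seq (v i) n ℚ.- 0ℚ ∣ ℚ.≤ δ)
    choose k 0<k K≡k = N₀ ℕ.⊔ proj₁ close , λ n N≤n →
      let N₀≤n = ℕₚ.m⊔n≤o⇒m≤o N₀ (proj₁ close) N≤n
          N₁≤n = ℕₚ.m⊔n≤o⇒n≤o N₀ (proj₁ close) N≤n
      in ℚₚ.*-cancelˡ-≤-pos γ (begin
        γ ℚ.* ℚ.∣ seq (v i) n ℚ.- 0ℚ ∣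
          ≡⟨ cong (λ t → γ ℚ.* ℚ.∣ t ∣) (ℚₚ.+-identityʳ (seq (v i) n)) ⟩
        γ ℚ.* ℚ.∣ seq (v i) n ∣
          ≤⟨ approximate-eigenvector-small (λ i j → seq (B i j) n) (∣B∣≤1 n) (columns n)
               (seq l n) (λ i → seq (v i) n) (ℚₚ.<⇒≤ 0<γ) (1≤l (c+γ≤l n N₀≤n)) (c+γ≤l n N₀≤n)
               (λ i → subst (λ t → ℚ.∣ t ℚ.- seq l n ℚ.* seq (v i) n ∣ ℚ.≤ η) (seq-gram B v n i)
                 (proj₂ close n N₁≤n i))
               i ⟩
        K ℚ.* η
          ≡⟨ cong (ℚ._* η) K≡k ⟩
        k ℚ.* η
          ≡⟨ ℚₚ.*-assoc k (ℚ.1/ k) (γ ℚ.* δ) ⟨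
        k ℚ.* (ℚ.1/ k) ℚ.* (γ ℚ.* δ)
          ≡⟨ cong (ℚ._* (γ ℚ.* δ)) (ℚₚ.*-inverseʳ k) ⟩
        1ℚ ℚ.* (γ ℚ.* δ)
          ≡⟨ ℚₚ.*-identityˡ (γ ℚ.* δ) ⟩
        γ ℚ.* δ ∎)
      where
      instance
        k-pos : ℚ.Positive k
        k-pos = ℚ.positive 0<k
        k-nonZero : ℚ.NonZero k
        k-nonZero = ℚₚ.pos⇒nonZero k
      -- Solves `k * η = γ * δ`, so that cancelling `γ` leaves exactly the tolerance `δ`.
      η : ℚ
      η = ℚ.1/ k ℚ.* (γ ℚ.* δ)
      0<η : 0ℚ ℚ.< η
      0<η = ℚₚ.positive⁻¹ η {{ℚₚ.pos*pos⇒pos (ℚ.1/ k) {{ℚₚ.1/pos⇒pos k}} (γ ℚ.* δ)}}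
      close : ∃[ N ] (∀ n → N ℕ.≤ n → ∀ i →
        ℚ.∣ seq (((B · B ᵀ) ·ᵥ v) i) n ℚ.- seq l n ℚ.* seq (v i) n ∣ ℚ.≤ η)
      close = eventually-all λ i → eigen i η 0<η

  eigenvalue-≤ : ∀ l → IsEigenvalue (B · B ᵀ) l → l ≤ fromℚ c
  eigenvalue-≤ l (v , v≉0 , eigen) = ≮⇒≤ l c λ (_ , 0<γ , _ , c+γ≤l) →
    v≉0 (eigenvector-null l v 0<γ c+γ≤l eigen)

-- Boundary coefficients

Unique⇒lookup-injective : ∀ {A : Set} {xs : List A} → Unique xs →
  ∀ i j → lookup xs i ≡ lookup xs j → i ≡ j
Unique⇒lookup-injective (x∉xs ∷ u) zero    zero    eq = refl
Unique⇒lookup-injective (x∉xs ∷ u) zero    (suc j) eq = contradiction eq (All.lookup x∉xs (∈-lookup j))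
Unique⇒lookup-injective (x∉xs ∷ u) (suc i) zero    eq = contradiction (sym eq) (All.lookup x∉xs (∈-lookup i))
Unique⇒lookup-injective (x∉xs ∷ u) (suc i) (suc j) eq = cong suc (Unique⇒lookup-injective u i j eq)

subsets-unique : ∀ n → Unique (subsets n)
subsets-unique ℕ.zero    = [] ∷ []
subsets-unique (ℕ.suc n) = ++⁺ (map⁺ ∷ᵛ-injectiveʳ (subsets-unique n)) (map⁺ ∷ᵛ-injectiveʳ (subsets-unique n)) disjoint
  where
  disjoint : Disjoint (map (outside ∷_) (subsets n)) (map (inside ∷_) (subsets n))
  disjoint (p , q) with ∈-map⁻ (outside ∷_) p | ∈-map⁻ (inside ∷_) q
  ... | _ , _ , refl | _ , _ , ()

-- `vertices` filters `tabulate id`, but passing to the tail composes with `suc`; hence the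
-- arbitrary `f`.
length-filter-tabulate : ∀ {A : Set} {P : Pred A 0ℓ} (P? : Decidable P) {n} (f : Fin n → A) (σ : Subset n) →
  (∀ i → P (f i) → i ∈ σ) → length (filter P? (tabulate f)) ℕ.≤ ∣ σ ∣
length-filter-tabulate P? f []      P⇒∈ = ℕ.z≤n
length-filter-tabulate P? f (s ∷ σ) P⇒∈
  with ih ← length-filter-tabulate P? (f ∘ suc) σ (λ i → drop-there ∘ P⇒∈ (suc i)) | P? (f zero) | s
... | yes p | inside  = ℕ.s≤s ih
... | yes p | outside = contradiction (P⇒∈ zero p) λ ()
... | no _  | inside  = ℕₚ.m≤n⇒m≤1+n ih
... | no _  | outside = ih

∣vertices∣≤ : ∀ {n} (σ : Subset n) → length (vertices σ) ℕ.≤ ∣ σ ∣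
∣vertices∣≤ σ = length-filter-tabulate (_∈? σ) id σ λ _ → id

-- The inclusion of `p - x` in `p` is strict, and `x` is the only element that can witness this.
x∉p-x : ∀ {n} {p : Subset n} {x} → x ∈ p → x ∉ p - x
x∉p-x {p = p} {x} x∈p x∈p-x = contradiction x∈p-x (helper (proj₂ (x∈p⇒p-x⊂p x∈p)))
  where
  helper : ∃[ y ] (y ∈ p × y ∉ p - x) → x ∉ p - x
  helper (y , y∈p , y∉) with y ≟ᶠ x
  ... | yes refl = y∉
  ... | no y≢x   = contradiction (x∈p∧x≢y⇒x∈p-y y∈p y≢x) y∉

-‿injective : ∀ {n} {p : Subset n} {x y} → x ∈ p → p - x ≡ p - y → x ≡ y
-‿injective {x = x} {y} x∈p eq with x ≟ᶠ y
... | yes x≡y = x≡y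
... | no x≢y  = contradiction (subst (x ∈_) (sym eq) (x∈p∧x≢y⇒x∈p-y x∈p x≢y)) (x∉p-x x∈p)

-- Faces of codimension one

infix 4 _≺_

-- The covering relation of the Boolean lattice: what a nonzero boundary coefficient says once sign
-- and position are forgotten.
_≺_ : ∀ {n} → Subset n → Subset n → Set
σ ≺ τ = ∃[ x ] (x ∈ τ × τ - x ≡ σ)

≺⇒⊆ : ∀ {n} {σ τ : Subset n} → σ ≺ τ → σ ⊆ τ
≺⇒⊆ {τ = τ} (x , _ , refl) = p─q⊆p τ _

-- If σ = τ - x also lies below τ′ ≠ τ, then x ∉ τ′, so σ = τ ∩ τ′.
≺-unique : ∀ {n} {σ σ′ τ τ′ : Subset n} → τ ≢ τ′ → σ ≺ τ → σ ≺ τ′ → σ′ ≺ τ → σ′ ≺ τ′ → σ ≡ σ′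
≺-unique τ≢τ′ σ≺τ σ≺τ′ σ′≺τ σ′≺τ′ = ⊆-antisym
  (λ x∈σ → ∩⊆ τ≢τ′ σ′≺τ σ′≺τ′ (≺⇒⊆ σ≺τ x∈σ) (≺⇒⊆ σ≺τ′ x∈σ))
  (λ x∈σ′ → ∩⊆ τ≢τ′ σ≺τ σ≺τ′ (≺⇒⊆ σ′≺τ x∈σ′) (≺⇒⊆ σ′≺τ′ x∈σ′))
  where
  refill : ∀ {n} {τ τ′ : Subset n} {x} → x ∈ τ′ → τ - x ≡ τ′ - x → τ ⊆ τ′
  refill {τ = τ} {τ′} {x} x∈τ′ eq {z} z∈τ with z ≟ᶠ x
  ... | yes refl = x∈τ′
  ... | no z≢x   = p─q⊆p τ′ _ (subst (z ∈_) eq (x∈p∧x≢y⇒x∈p-y z∈τ z≢x))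
  ∩⊆ : ∀ {n} {σ τ τ′ : Subset n} → τ ≢ τ′ → σ ≺ τ → σ ≺ τ′ → ∀ {z} → z ∈ τ → z ∈ τ′ → z ∈ σ
  ∩⊆ τ≢τ′ (x , x∈τ , refl) (y , y∈τ′ , eq) {z} z∈τ z∈τ′ with z ≟ᶠ x
  ... | no z≢x = x∈p∧x≢y⇒x∈p-y z∈τ z≢x
  ... | yes refl with z ≟ᶠ y
  -- The same vertex is removed from both sets; putting it back identifies `τ` with `τ′`.
  ...   | yes refl = contradiction (⊆-antisym (refill y∈τ′ (sym eq)) (refill x∈τ eq)) τ≢τ′
  ...   | no z≢y   = subst (z ∈_) eq (x∈p∧x≢y⇒x∈p-y z∈τ′ z≢y)

sign-cases : ∀ j → -1ℤ ℤ.^ j ≡ 1ℤ ⊎ -1ℤ ℤ.^ j ≡ -1ℤ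
sign-cases ℕ.zero = inj₁ refl
sign-cases (ℕ.suc j) with sign-cases j
... | inj₁ eq = inj₂ (cong (-1ℤ ℤ.*_) eq)
... | inj₂ eq = inj₁ (cong (-1ℤ ℤ.*_) eq)

∣sign∣≡1 : ∀ j → ℚ.∣ (-1ℤ ℤ.^ j) ℚ./ 1 ∣ ≡ 1ℚ
∣sign∣≡1 j with sign-cases j
... | inj₁ eq = cong (λ z → ℚ.∣ z ℚ./ 1 ∣) eq
... | inj₂ eq = cong (λ z → ℚ.∣ z ℚ./ 1 ∣) eq

facet : ∀ {n} (τ : Subset n) → Fin (length (vertices τ)) → Subset n
facet τ j = τ - lookup (vertices τ) j

module _ {n : ℕ} (σ τ : Subset n) where

  ∂-term : Fin (length (vertices τ)) → ℝ
  ∂-term j = if does (facet τ j ≟ₛ σ) then fromℚ ((-1ℤ ℤ.^ toℕ j) ℚ./ 1) else 0ℝ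

  ∂-term-cases : ∀ N j → (facet τ j ≡ σ × ℚ.∣ seq (∂-term j) N ∣ ≡ 1ℚ) ⊎ seq (∂-term j) N ≡ 0ℚ
  ∂-term-cases N j with facet τ j ≟ₛ σ
  ... | yes eq = inj₁ (eq , ∣sign∣≡1 (toℕ j))
  ... | no _   = inj₂ refl

vertices-∈ : ∀ {n} (τ : Subset n) j → lookup (vertices τ) j ∈ τ
vertices-∈ {n} τ j = proj₂ (∈-filter⁻ (_∈? τ) {xs = allFin n} (∈-lookup {xs = vertices τ} j))

facet-injective : ∀ {n} (τ : Subset n) i j → τ - lookup (vertices τ) i ≡ τ - lookup (vertices τ) j → i ≡ j
facet-injective {n} τ i j eq = Unique⇒lookup-injective (filter⁺ (_∈? τ) (allFin⁺ n)) i j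
  (-‿injective (vertices-∈ τ i) eq)


-- Natural numbers as rationals

fromℕ : ℕ → ℚ
fromℕ k = + k ℚ./ 1

-- `+ k / 1` is normalised through a gcd and does not compute for variable `k`, so the equation is
-- checked by cross-multiplication of unnormalised fractions.
fromℕ-suc : ∀ k → fromℕ (ℕ.suc k) ≡ 1ℚ ℚ.+ fromℕ k
fromℕ-suc k = ℚₚ.toℚᵘ-injective (begin-equality
  ℚ.toℚᵘ (fromℕ (ℕ.suc k))                   ≃⟨ ℚₚ.toℚᵘ-fromℚᵘ (ℚᵘ.mkℚᵘ (+ ℕ.suc k) 0) ⟩
  ℚᵘ.mkℚᵘ (+ ℕ.suc k) 0                      ≃⟨ ℚᵘ.*≡* (cong (ℤ._* 1ℤ) (cong (λ z → 1ℤ ℤ.+ z) (sym (ℤₚ.*-identityʳ (+ k))))) ⟩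
  ℚᵘ.1ℚᵘ ℚᵘ.+ ℚᵘ.mkℚᵘ (+ k) 0                ≃⟨ ℚᵘₚ.+-congʳ ℚᵘ.1ℚᵘ (ℚₚ.toℚᵘ-fromℚᵘ (ℚᵘ.mkℚᵘ (+ k) 0)) ⟨
  ℚᵘ.1ℚᵘ ℚᵘ.+ ℚ.toℚᵘ (fromℕ k)               ≃⟨ ℚₚ.toℚᵘ-homo-+ 1ℚ (fromℕ k) ⟨
  ℚ.toℚᵘ (1ℚ ℚ.+ fromℕ k)                    ∎)
  where open ℚᵘₚ.≤-Reasoning

sum-ones : ∀ k → sum {k} (λ _ → 1ℚ) ≡ fromℕ k
sum-ones ℕ.zero    = refl
sum-ones (ℕ.suc k) = trans (cong (1ℚ ℚ.+_) (sum-ones k)) (sym (fromℕ-suc k))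

0≤fromℕ : ∀ k → 0ℚ ℚ.≤ fromℕ k
0≤fromℕ k = subst (0ℚ ℚ.≤_) (sum-ones k) (sum-nonNeg {k} λ _ → ℚₚ.nonNegative⁻¹ 1ℚ)

fromℕ-mono-≤ : ∀ {k l} → k ℕ.≤ l → fromℕ k ℚ.≤ fromℕ l
fromℕ-mono-≤ {l = l} ℕ.z≤n = 0≤fromℕ l
fromℕ-mono-≤ {ℕ.suc k} {ℕ.suc l} (ℕ.s≤s k≤l) = begin
  fromℕ (ℕ.suc k)    ≡⟨ fromℕ-suc k ⟩
  1ℚ ℚ.+ fromℕ k     ≤⟨ ℚₚ.+-monoʳ-≤ 1ℚ (fromℕ-mono-≤ k≤l) ⟩
  1ℚ ℚ.+ fromℕ l     ≡⟨ fromℕ-suc l ⟨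
  fromℕ (ℕ.suc l)    ∎
  where open ℚₚ.≤-Reasoning

-- Entries of ∂ and column sums of ∂ᵀ∂, at a fixed index of the sequences

module _ {n : ℕ} (N : ℕ) where

  private
    ∂ : Subset n → Subset n → ℚ
    ∂ σ τ = seq (∂-coefficient σ τ) N

    term : (σ τ : Subset n) → Fin (length (vertices τ)) → ℚ
    term σ τ j = seq (∂-term σ τ j) N

    ∂≡∑ : ∀ σ τ → ∂ σ τ ≡ sum (term σ τ)
    ∂≡∑ σ τ = seq-∑ (∂-term σ τ) N

    ∣term∣≤1 : ∀ σ τ j → ℚ.∣ term σ τ j ∣ ℚ.≤ 1ℚ
    ∣term∣≤1 σ τ j with ∂-term-cases σ τ N j
    ... | inj₁ (_ , eq) = ℚₚ.≤-reflexive eq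
    ... | inj₂ eq = subst (λ t → ℚ.∣ t ∣ ℚ.≤ 1ℚ) (sym eq) (ℚₚ.nonNegative⁻¹ 1ℚ)

    term≢0 : ∀ σ τ j → ℚ.∣ term σ τ j ∣ ≢ 0ℚ → facet τ j ≡ σ
    term≢0 σ τ j ≢0 with ∂-term-cases σ τ N j
    ... | inj₁ (eq , _) = eq
    ... | inj₂ eq = contradiction (cong ℚ.∣_∣ eq) ≢0

  ∣∂∣≤∑ : ∀ σ τ → ℚ.∣ ∂ σ τ ∣ ℚ.≤ sum (ℚ.∣_∣ ∘ term σ τ)
  ∣∂∣≤∑ σ τ = subst (λ t → ℚ.∣ t ∣ ℚ.≤ sum (ℚ.∣_∣ ∘ term σ τ)) (sym (∂≡∑ σ τ)) (∣sum∣≤sum∣∣ (term σ τ))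

  -- Removing different vertices of `τ` gives different facets, so at most one signed term of the
  -- coefficient survives.
  ∣∂∣≤1 : ∀ σ τ → ℚ.∣ ∂ σ τ ∣ ℚ.≤ 1ℚ
  ∣∂∣≤1 σ τ = ℚₚ.≤-trans (∣∂∣≤∑ σ τ)
    (sum-atMostOne (ℚ.∣_∣ ∘ term σ τ) (ℚₚ.nonNegative⁻¹ 1ℚ) (∣term∣≤1 σ τ)
      λ i j ≢0 ≢0′ → facet-injective τ i j (trans (term≢0 σ τ i ≢0) (sym (term≢0 σ τ j ≢0′))))

  ∂≢0⇒≺ : ∀ σ τ → ∂ σ τ ≢ 0ℚ → σ ≺ τ
  ∂≢0⇒≺ σ τ ∂≢0 = from-dec (any? (λ j → facet τ j ≟ₛ σ))
    where
    vanish : ¬ (∃[ j ] facet τ j ≡ σ) → ∀ j → term σ τ j ≡ 0ℚ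
    vanish none j = [ (λ (eq , _) → contradiction (j , eq) none) , id ]′ (∂-term-cases σ τ N j)
    from-dec : Dec (∃[ j ] facet τ j ≡ σ) → σ ≺ τ
    from-dec (yes (j , eq)) = lookup (vertices τ) j , vertices-∈ τ j , eq
    from-dec (no none)      = contradiction
      (trans (∂≡∑ σ τ) (trans (sum-cong-≗ (vanish none)) (sum-replicate-zero (length (vertices τ))))) ∂≢0

  -- Double counting: with the sums exchanged, each vertex position of `τ` contributes at most 1,
  -- because its facet equals at most one of the distinct `ρ i`.
  ∑∣∂∣≤ : ∀ {m} (ρ : Fin m → Subset n) → (∀ i j → ρ i ≡ ρ j → i ≡ j) → ∀ τ →
    sum (λ i → ℚ.∣ ∂ (ρ i) τ ∣) ℚ.≤ fromℕ ∣ τ ∣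
  ∑∣∂∣≤ ρ ρ-injective τ = begin
    sum (λ i → ℚ.∣ ∂ (ρ i) τ ∣)
      ≤⟨ sum-mono-≤ (λ i → ∣∂∣≤∑ (ρ i) τ) ⟩
    sum (λ i → sum (λ l → ℚ.∣ term (ρ i) τ l ∣))
      ≡⟨ ∑-comm (λ i l → ℚ.∣ term (ρ i) τ l ∣) ⟩
    sum (λ l → sum (λ i → ℚ.∣ term (ρ i) τ l ∣))
      ≤⟨ sum-mono-≤ (λ l → sum-atMostOne (λ i → ℚ.∣ term (ρ i) τ l ∣) (ℚₚ.nonNegative⁻¹ 1ℚ)
           (λ i → ∣term∣≤1 (ρ i) τ l)
           λ i j ≢0 ≢0′ → ρ-injective i j (trans (sym (term≢0 (ρ i) τ l ≢0)) (term≢0 (ρ j) τ l ≢0′))) ⟩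
    sum {length (vertices τ)} (λ _ → 1ℚ)
      ≡⟨ sum-ones (length (vertices τ)) ⟩
    fromℕ (length (vertices τ))
      ≤⟨ fromℕ-mono-≤ (∣vertices∣≤ τ) ⟩
    fromℕ ∣ τ ∣ ∎
    where open ℚₚ.≤-Reasoning

  ∂-columns : ∀ {m p} (ρ : Fin m → Subset n) (θ : Fin p → Subset n) →
    (∀ i j → ρ i ≡ ρ j → i ≡ j) → (∀ i j → θ i ≡ θ j → i ≡ j) →
    ∀ {r} → (∀ k → ∣ θ k ∣ ℕ.≤ ℕ.suc r) → ∀ k →
    sum (λ j → ℚ.∣ sum (λ i → ∂ (ρ i) (θ j) ℚ.* ∂ (ρ i) (θ k)) ∣) ℚ.≤ fromℕ r ℚ.+ fromℕ p
  ∂-columns {p = p} ρ θ ρ-injective θ-injective {r} ∣θ∣≤ k =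
    subst (λ t → sum (λ j → ℚ.∣ sum (λ i → ∂ (ρ i) (θ j) ℚ.* ∂ (ρ i) (θ k)) ∣) ℚ.≤ fromℕ r ℚ.+ t) (sum-ones p)
      (sum-exceptional (λ j → ℚ.∣ sum (λ i → ∂ (ρ i) (θ j) ℚ.* ∂ (ρ i) (θ k)) ∣) k {fromℕ r} diagonal off-diagonal)
    where
    open ℚₚ.≤-Reasoning
    diagonal : ℚ.∣ sum (λ i → ∂ (ρ i) (θ k) ℚ.* ∂ (ρ i) (θ k)) ∣ ℚ.≤ fromℕ r ℚ.+ 1ℚ
    diagonal = begin
      ℚ.∣ sum (λ i → ∂ (ρ i) (θ k) ℚ.* ∂ (ρ i) (θ k)) ∣
        ≤⟨ ∣sum∣≤sum∣∣ (λ i → ∂ (ρ i) (θ k) ℚ.* ∂ (ρ i) (θ k)) ⟩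
      sum (λ i → ℚ.∣ ∂ (ρ i) (θ k) ℚ.* ∂ (ρ i) (θ k) ∣)
        -- Entries have modulus at most 1, so squares are dominated by absolute values and the
        -- diagonal reduces to a column sum of `|∂|`.
        ≤⟨ sum-mono-≤ (λ i → ∣p*q∣≤∣q∣ (∂ (ρ i) (θ k)) (∂ (ρ i) (θ k)) (∣∂∣≤1 (ρ i) (θ k))) ⟩
      sum (λ i → ℚ.∣ ∂ (ρ i) (θ k) ∣)
        ≤⟨ ∑∣∂∣≤ ρ ρ-injective (θ k) ⟩
      fromℕ ∣ θ k ∣
        ≤⟨ fromℕ-mono-≤ (∣θ∣≤ k) ⟩
      fromℕ (ℕ.suc r)
        ≡⟨ trans (fromℕ-suc r) (ℚₚ.+-comm 1ℚ (fromℕ r)) ⟩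
      fromℕ r ℚ.+ 1ℚ ∎
    off-diagonal : ∀ j → j ≢ k → ℚ.∣ sum (λ i → ∂ (ρ i) (θ j) ℚ.* ∂ (ρ i) (θ k)) ∣ ℚ.≤ 1ℚ
    off-diagonal j j≢k = ℚₚ.≤-trans (∣sum∣≤sum∣∣ λ i → ∂ (ρ i) (θ j) ℚ.* ∂ (ρ i) (θ k))
      (sum-atMostOne (λ i → ℚ.∣ ∂ (ρ i) (θ j) ℚ.* ∂ (ρ i) (θ k) ∣) (ℚₚ.nonNegative⁻¹ 1ℚ)
        (λ i → ℚₚ.≤-trans (∣p*q∣≤∣q∣ (∂ (ρ i) (θ j)) (∂ (ρ i) (θ k)) (∣∂∣≤1 (ρ i) (θ j))) (∣∂∣≤1 (ρ i) (θ k)))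
        λ i i′ ≢0 ≢0′ → ρ-injective i i′ (≺-unique (λ eq → j≢k (θ-injective j k eq))
          (left i ≢0) (right i ≢0) (left i′ ≢0′) (right i′ ≢0′)))
      where
      left : ∀ i → ℚ.∣ ∂ (ρ i) (θ j) ℚ.* ∂ (ρ i) (θ k) ∣ ≢ 0ℚ → ρ i ≺ θ j
      left i ≢0 = ∂≢0⇒≺ (ρ i) (θ j) λ eq → ≢0 (cong ℚ.∣_∣
        (trans (cong (ℚ._* ∂ (ρ i) (θ k)) eq) (ℚₚ.*-zeroˡ (∂ (ρ i) (θ k)))))
      right : ∀ i → ℚ.∣ ∂ (ρ i) (θ j) ℚ.* ∂ (ρ i) (θ k) ∣ ≢ 0ℚ → ρ i ≺ θ k
      right i ≢0 = ∂≢0⇒≺ (ρ i) (θ k) λ eq → ≢0 (cong ℚ.∣_∣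
        (trans (cong (∂ (ρ i) (θ j) ℚ.*_) eq) (ℚₚ.*-zeroʳ (∂ (ρ i) (θ j)))))

-- Counting subsets

length-filter-map : ∀ {A B : Set} {P : Pred B 0ℓ} (P? : Decidable P) (g : A → B) xs →
  length (filter P? (map g xs)) ≡ length (filter (P? ∘ g) xs)
length-filter-map P? g []       = refl
length-filter-map P? g (x ∷ xs) with P? (g x)
... | yes _ = cong ℕ.suc (length-filter-map P? g xs)
... | no _  = length-filter-map P? g xs

length-filter-subsets : ∀ {n} {P : Pred (Subset (ℕ.suc n)) 0ℓ} (P? : Decidable P) →
  length (filter P? (subsets (ℕ.suc n))) ≡
  length (filter (P? ∘ (outside ∷_)) (subsets n)) ℕ.+ length (filter (P? ∘ (inside ∷_)) (subsets n))
length-filter-subsets {n} P? = begin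
  length (filter P? (map (outside ∷_) (subsets n) ++ map (inside ∷_) (subsets n)))
    ≡⟨ cong length (filter-++ P? (map (outside ∷_) (subsets n)) _) ⟩
  length (filter P? (map (outside ∷_) (subsets n)) ++ filter P? (map (inside ∷_) (subsets n)))
    ≡⟨ length-++ (filter P? (map (outside ∷_) (subsets n))) ⟩
  length (filter P? (map (outside ∷_) (subsets n))) ℕ.+ length (filter P? (map (inside ∷_) (subsets n)))
    ≡⟨ cong₂ ℕ._+_ (length-filter-map P? (outside ∷_) (subsets n)) (length-filter-map P? (inside ∷_) (subsets n)) ⟩
  length (filter (P? ∘ (outside ∷_)) (subsets n)) ℕ.+ length (filter (P? ∘ (inside ∷_)) (subsets n)) ∎
  where open ≡-Reasoning

-- Pascal's rule along the elements of `τ`: dropping one uses up one of the `d` omissions, keeping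
-- it uses none. Counting by omissions avoids subtraction, and the arbitrary `P` lets the induction
-- restrict to either half of the subsets.
C≤length-filter-subsets : ∀ {n} (τ : Subset n) d {P : Pred (Subset n) 0ℓ} (P? : Decidable P) →
  (∀ σ → σ ⊆ τ → ∣ σ ∣ ℕ.+ d ≡ ∣ τ ∣ → P σ) → ∣ τ ∣ C d ℕ.≤ length (filter P? (subsets n))
C≤length-filter-subsets [] ℕ.zero P? sub⇒P with P? []
... | yes _ = ℕ.s≤s ℕ.z≤n
... | no ¬p = contradiction (sub⇒P [] id refl) ¬p
C≤length-filter-subsets [] (ℕ.suc d) P? sub⇒P = ℕ.z≤n
C≤length-filter-subsets (outside ∷ τ) d P? sub⇒P =
  subst (∣ τ ∣ C d ℕ.≤_) (sym (length-filter-subsets P?))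
    (ℕₚ.m≤n⇒m≤n+o _ (C≤length-filter-subsets τ d (P? ∘ (outside ∷_)) λ σ σ⊆τ → sub⇒P (outside ∷ σ) (out⊆ σ⊆τ)))
C≤length-filter-subsets (inside ∷ τ) ℕ.zero P? sub⇒P =
  subst (1 ℕ.≤_) (sym (length-filter-subsets P?))
    (ℕₚ.m≤n⇒m≤o+n _ (C≤length-filter-subsets τ ℕ.zero (P? ∘ (inside ∷_)) λ σ σ⊆τ eq →
      sub⇒P (inside ∷ σ) (in⊆in σ⊆τ) (cong ℕ.suc eq)))
C≤length-filter-subsets (inside ∷ τ) (ℕ.suc d) P? sub⇒P = begin
  ℕ.suc ∣ τ ∣ C ℕ.suc d
    ≡⟨ nCk+nC[k+1]≡[n+1]C[k+1] ∣ τ ∣ d ⟨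
  ∣ τ ∣ C d ℕ.+ ∣ τ ∣ C ℕ.suc d
    ≤⟨ ℕₚ.+-mono-≤
         (C≤length-filter-subsets τ d (P? ∘ (outside ∷_)) λ σ σ⊆τ eq →
           sub⇒P (outside ∷ σ) (out⊆ σ⊆τ) (trans (ℕₚ.+-suc ∣ σ ∣ d) (cong ℕ.suc eq)))
         (C≤length-filter-subsets τ (ℕ.suc d) (P? ∘ (inside ∷_)) λ σ σ⊆τ eq →
           sub⇒P (inside ∷ σ) (in⊆in σ⊆τ) (cong ℕ.suc eq)) ⟩
  length (filter (P? ∘ (outside ∷_)) (subsets _)) ℕ.+ length (filter (P? ∘ (inside ∷_)) (subsets _))
    ≡⟨ length-filter-subsets P? ⟨
  length (filter P? (subsets _)) ∎
  where open ℕₚ.≤-Reasoning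

-- Stated doubled to avoid halving in ℕ; the induction is Pascal's rule.
2*[n+1]C2≡n*[n+1] : ∀ n → 2 ℕ.* (ℕ.suc n C 2) ≡ n ℕ.* ℕ.suc n
2*[n+1]C2≡n*[n+1] ℕ.zero    = refl
2*[n+1]C2≡n*[n+1] (ℕ.suc n) = begin
  2 ℕ.* (ℕ.suc (ℕ.suc n) C 2)
    ≡⟨ cong (2 ℕ.*_) (nCk+nC[k+1]≡[n+1]C[k+1] (ℕ.suc n) 1) ⟨
  2 ℕ.* (ℕ.suc n C 1 ℕ.+ ℕ.suc n C 2)
    ≡⟨ cong (λ t → 2 ℕ.* (t ℕ.+ ℕ.suc n C 2)) (nC1≡n (ℕ.suc n)) ⟩
  2 ℕ.* (ℕ.suc n ℕ.+ ℕ.suc n C 2)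
    ≡⟨ ℕₚ.*-distribˡ-+ 2 (ℕ.suc n) (ℕ.suc n C 2) ⟩
  2 ℕ.* ℕ.suc n ℕ.+ 2 ℕ.* (ℕ.suc n C 2)
    ≡⟨ cong (2 ℕ.* ℕ.suc n ℕ.+_) (2*[n+1]C2≡n*[n+1] n) ⟩
  2 ℕ.* ℕ.suc n ℕ.+ n ℕ.* ℕ.suc n
    ≡⟨ ℕₚ.*-distribʳ-+ (ℕ.suc n) 2 n ⟨
  (2 ℕ.+ n) ℕ.* ℕ.suc n
    ≡⟨ ℕₚ.*-comm (2 ℕ.+ n) (ℕ.suc n) ⟩
  ℕ.suc n ℕ.* ℕ.suc (ℕ.suc n) ∎
  where open ≡-Reasoning

-- The bound

fromℕ-* : ∀ k l → fromℕ (k ℕ.* l) ≡ fromℕ k ℚ.* fromℕ l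
fromℕ-* ℕ.zero    l = sym (ℚₚ.*-zeroˡ (fromℕ l))
fromℕ-* (ℕ.suc k) l = begin
  fromℕ (l ℕ.+ k ℕ.* l)                    ≡⟨ fromℕ-+ l (k ℕ.* l) ⟩
  fromℕ l ℚ.+ fromℕ (k ℕ.* l)              ≡⟨ cong (fromℕ l ℚ.+_) (fromℕ-* k l) ⟩
  fromℕ l ℚ.+ fromℕ k ℚ.* fromℕ l          ≡⟨ factor (fromℕ k) (fromℕ l) ⟩
  (1ℚ ℚ.+ fromℕ k) ℚ.* fromℕ l             ≡⟨ cong (ℚ._* fromℕ l) (fromℕ-suc k) ⟨
  fromℕ (ℕ.suc k) ℚ.* fromℕ l              ∎
  where
  open ≡-Reasoning
  factor : ∀ x y → y ℚ.+ x ℚ.* y ≡ (1ℚ ℚ.+ x) ℚ.* y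
  factor = solve-∀ ℚ-ring
  fromℕ-+ : ∀ k l → fromℕ (k ℕ.+ l) ≡ fromℕ k ℚ.+ fromℕ l
  fromℕ-+ ℕ.zero    l = sym (ℚₚ.+-identityˡ (fromℕ l))
  fromℕ-+ (ℕ.suc k) l = begin
    fromℕ (ℕ.suc k ℕ.+ l)          ≡⟨ fromℕ-suc (k ℕ.+ l) ⟩
    1ℚ ℚ.+ fromℕ (k ℕ.+ l)         ≡⟨ cong (1ℚ ℚ.+_) (fromℕ-+ k l) ⟩
    1ℚ ℚ.+ (fromℕ k ℚ.+ fromℕ l)   ≡⟨ ℚₚ.+-assoc 1ℚ (fromℕ k) (fromℕ l) ⟨
    1ℚ ℚ.+ fromℕ k ℚ.+ fromℕ l     ≡⟨ cong (ℚ._+ fromℕ l) (fromℕ-suc k) ⟨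
    fromℕ (ℕ.suc k) ℚ.+ fromℕ l    ∎

/-*-cancel : ∀ a d → (+ a ℚ./ ℕ.suc d) ℚ.* fromℕ (ℕ.suc d) ≡ fromℕ a
/-*-cancel a d = ℚₚ.toℚᵘ-injective (begin-equality
  ℚ.toℚᵘ ((+ a ℚ./ ℕ.suc d) ℚ.* fromℕ (ℕ.suc d))
    ≃⟨ ℚₚ.toℚᵘ-homo-* (+ a ℚ./ ℕ.suc d) (fromℕ (ℕ.suc d)) ⟩
  ℚ.toℚᵘ (+ a ℚ./ ℕ.suc d) ℚᵘ.* ℚ.toℚᵘ (fromℕ (ℕ.suc d))
    ≃⟨ ℚᵘₚ.*-cong (ℚₚ.toℚᵘ-fromℚᵘ (ℚᵘ.mkℚᵘ (+ a) d)) (ℚₚ.toℚᵘ-fromℚᵘ (ℚᵘ.mkℚᵘ (+ ℕ.suc d) 0)) ⟩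
  ℚᵘ.mkℚᵘ (+ a) d ℚᵘ.* ℚᵘ.mkℚᵘ (+ ℕ.suc d) 0
    ≃⟨ ℚᵘ.*≡* (trans (ℤₚ.*-identityʳ (+ a ℤ.* + ℕ.suc d))
         (cong (λ k → + a ℤ.* + k) (sym (ℕₚ.*-identityʳ (ℕ.suc d))))) ⟩
  ℚᵘ.mkℚᵘ (+ a) 0
    ≃⟨ ℚₚ.toℚᵘ-fromℚᵘ (ℚᵘ.mkℚᵘ (+ a) 0) ⟨
  ℚ.toℚᵘ (fromℕ a) ∎)
  where open ℚᵘₚ.≤-Reasoning

r+f≤bound : ∀ r .{{_ : NonZero r}} {f g} → 1 ℕ.≤ f → r ℕ.* ℕ.suc r ℕ.≤ 2 ℕ.* g →
  fromℕ r ℚ.+ fromℕ f ℚ.≤ (+ ℕ.suc r ℚ./ 2) ℚ.* (+ f ℚ./ 1) ℚ.+ (+ g ℚ./ r)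
r+f≤bound r@(ℕ.suc r-1) {f} {g} 1≤f r[r+1]≤2g = bound (+ ℕ.suc r ℚ./ 2) (+ g ℚ./ r) (/-*-cancel (ℕ.suc r) 1) (/-*-cancel g r-1)
  where
  open ℚₚ.≤-Reasoning
  -- The quotients `(r + 1) / 2` and `g / r` enter only through the equations that clear their
  -- denominators.
  bound : ∀ x y → x ℚ.* fromℕ 2 ≡ fromℕ (ℕ.suc r) → y ℚ.* fromℕ r ≡ fromℕ g →
    fromℕ r ℚ.+ fromℕ f ℚ.≤ x ℚ.* fromℕ f ℚ.+ y
  bound x y 2x≡1+r yr≡g = begin
    fromℕ r ℚ.+ fromℕ f
      ≡⟨ cong (ℚ._+ fromℕ f) r≡ ⟩
    x ℚ.+ x ℚ.- 1ℚ ℚ.+ fromℕ f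
      ≡⟨ ℚₚ.+-identityʳ (x ℚ.+ x ℚ.- 1ℚ ℚ.+ fromℕ f) ⟨
    x ℚ.+ x ℚ.- 1ℚ ℚ.+ fromℕ f ℚ.+ 0ℚ
      ≤⟨ ℚₚ.+-monoʳ-≤ (x ℚ.+ x ℚ.- 1ℚ ℚ.+ fromℕ f) 0≤product ⟩
    x ℚ.+ x ℚ.- 1ℚ ℚ.+ fromℕ f ℚ.+ (x ℚ.- 1ℚ) ℚ.* (fromℕ f ℚ.- 1ℚ)
      ≡⟨ expand x (fromℕ f) ⟩
    x ℚ.* fromℕ f ℚ.+ x
      ≤⟨ ℚₚ.+-monoʳ-≤ (x ℚ.* fromℕ f) x≤y ⟩
    x ℚ.* fromℕ f ℚ.+ y ∎
    where
    expand : ∀ x z → x ℚ.+ x ℚ.- 1ℚ ℚ.+ z ℚ.+ (x ℚ.- 1ℚ) ℚ.* (z ℚ.- 1ℚ) ≡ x ℚ.* z ℚ.+ x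
    expand = solve-∀ ℚ-ring
    double : ∀ x → x ℚ.* (1ℚ ℚ.+ 1ℚ) ≡ x ℚ.+ x
    double = solve-∀ ℚ-ring
    isolate : ∀ x → x ≡ 1ℚ ℚ.+ x ℚ.- 1ℚ
    isolate = solve-∀ ℚ-ring
    x+x≡1+r : x ℚ.+ x ≡ 1ℚ ℚ.+ fromℕ r
    x+x≡1+r = trans (sym (double x)) (trans 2x≡1+r (fromℕ-suc r))
    r≡ : fromℕ r ≡ x ℚ.+ x ℚ.- 1ℚ
    r≡ = trans (isolate (fromℕ r)) (cong (ℚ._- 1ℚ) (sym x+x≡1+r))
    instance
      2-pos : ℚ.Positive (fromℕ 2)
      2-pos = _
      r-pos : ℚ.Positive (fromℕ r)
      r-pos = ℚₚ.normalize-pos r 1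
    0≤p-1 : ∀ {p} → 1ℚ ℚ.≤ p → 0ℚ ℚ.≤ p ℚ.- 1ℚ
    0≤p-1 {p} 1≤p = ℚₚ.+-monoˡ-≤ (ℚ.- 1ℚ) 1≤p
    1≤x : 1ℚ ℚ.≤ x
    1≤x = ℚₚ.*-cancelʳ-≤-pos (fromℕ 2) (begin
      1ℚ ℚ.* fromℕ 2     ≡⟨ ℚₚ.*-identityˡ (fromℕ 2) ⟩
      fromℕ 2            ≤⟨ fromℕ-mono-≤ {2} {ℕ.suc r} (ℕ.s≤s (ℕ.s≤s ℕ.z≤n)) ⟩
      fromℕ (ℕ.suc r)    ≡⟨ 2x≡1+r ⟨
      x ℚ.* fromℕ 2      ∎)
    0≤product : 0ℚ ℚ.≤ (x ℚ.- 1ℚ) ℚ.* (fromℕ f ℚ.- 1ℚ)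
    0≤product = begin
      0ℚ                                    ≡⟨ ℚₚ.*-zeroʳ (x ℚ.- 1ℚ) ⟨
      (x ℚ.- 1ℚ) ℚ.* 0ℚ                     ≤⟨ ℚₚ.*-monoˡ-≤-nonNeg (x ℚ.- 1ℚ) {{ℚ.nonNegative (0≤p-1 1≤x)}}
                                                 (0≤p-1 (fromℕ-mono-≤ {1} {f} 1≤f)) ⟩
      (x ℚ.- 1ℚ) ℚ.* (fromℕ f ℚ.- 1ℚ)       ∎
    -- Multiplying both sides by `2 r` leaves the face count `r (r + 1) ≤ 2 g`.
    x≤y : x ℚ.≤ y
    x≤y = ℚₚ.*-cancelʳ-≤-pos (fromℕ r) (ℚₚ.*-cancelˡ-≤-pos (fromℕ 2) (begin
      fromℕ 2 ℚ.* (x ℚ.* fromℕ r)          ≡⟨ swap (fromℕ 2) x (fromℕ r) ⟩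
      fromℕ r ℚ.* (x ℚ.* fromℕ 2)          ≡⟨ cong (fromℕ r ℚ.*_) 2x≡1+r ⟩
      fromℕ r ℚ.* fromℕ (ℕ.suc r)          ≡⟨ fromℕ-* r (ℕ.suc r) ⟨
      fromℕ (r ℕ.* ℕ.suc r)                ≤⟨ fromℕ-mono-≤ {r ℕ.* ℕ.suc r} {2 ℕ.* g} r[r+1]≤2g ⟩
      fromℕ (2 ℕ.* g)                      ≡⟨ fromℕ-* 2 g ⟩
      fromℕ 2 ℚ.* fromℕ g                  ≡⟨ cong (fromℕ 2 ℚ.*_) yr≡g ⟨
      fromℕ 2 ℚ.* (y ℚ.* fromℕ r)          ∎))
      where
      swap : ∀ x y z → x ℚ.* (y ℚ.* z) ≡ z ℚ.* (y ℚ.* x)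
      swap = solve-∀ ℚ-ring

-- Face counts of a complex and the eigenvalues of its up-Laplacian

dim≡+⇒∣∣≡suc : ∀ {n r} (σ : Subset n) → dim σ ≡ + r → ∣ σ ∣ ≡ ℕ.suc r
dim≡+⇒∣∣≡suc {r = r} σ eq = ℤₚ.+-injective (trans (add-one (+ ∣ σ ∣)) (cong ℤ.suc eq))
  where
  add-one : ∀ z → z ≡ 1ℤ ℤ.+ (z ℤ.- 1ℤ)
  add-one = solveℤ-∀

module _ {n : ℕ} (K : SimplicialComplex n) where
  open SimplicialComplex K

  S-unique : ∀ i → Unique (S K i)
  S-unique i = filter⁺ (λ σ → Face? σ ×-dec (dim σ ℤₚ.≟ i)) (subsets-unique n)

  dim-S : ∀ i k → dim (lookup (S K i) k) ≡ i
  dim-S i k = proj₂ (proj₂ (∈-filter⁻ (λ σ → Face? σ ×-dec (dim σ ℤₚ.≟ i)) {xs = subsets n} (∈-lookup {xs = S K i} k)))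

  -- Every subset of a face is a face. With `i` an integer, dimension -1 is included, which covers
  -- `r - 2` when `r` is 1.
  C≤f : ∀ {τ} → Face τ → ∀ d i → i ℤ.+ + d ≡ dim τ → ∣ τ ∣ C d ℕ.≤ f K i
  C≤f {τ} τ∈K d i i+d≡dim = C≤length-filter-subsets τ d (λ σ → Face? σ ×-dec (dim σ ℤₚ.≟ i)) λ σ σ⊆τ eq →
    closed σ⊆τ τ∈K , +-cancelʳ (+ d) (dim σ) i (begin
      + ∣ σ ∣ ℤ.- 1ℤ ℤ.+ + d      ≡⟨ swap (+ ∣ σ ∣) (+ d) ⟩
      + (∣ σ ∣ ℕ.+ d) ℤ.- 1ℤ      ≡⟨ cong (λ k → + k ℤ.- 1ℤ) eq ⟩
      dim τ                       ≡⟨ i+d≡dim ⟨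
      i ℤ.+ + d                   ∎)
    where
    open ≡-Reasoning
    swap : ∀ x y → x ℤ.- 1ℤ ℤ.+ y ≡ x ℤ.+ y ℤ.- 1ℤ
    swap = solveℤ-∀

  -- Columns are indexed by the faces of dimension `ℤ.suc i`, hence the equation relating this to
  -- `r`. Leaving `c` free allows the bound of the theorem to be inserted directly.
  Lᵘᵖ-eigenvalue-≤ : ∀ {r} i → ℤ.suc i ≡ + r → ∀ {c} → 1ℚ ℚ.≤ c →
    fromℕ r ℚ.+ fromℕ (f K (ℤ.suc i)) ℚ.≤ c → ∀ l → IsEigenvalue (Lᵘᵖ K i) l → l ≤ fromℚ c
  Lᵘᵖ-eigenvalue-≤ {r} i i+1≡r 1≤c r+f≤c = eigenvalue-≤ (B K (ℤ.suc i)) 1≤c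
    (λ N a b → ∣∂∣≤1 N (ρ a) (θ b))
    (λ N k → ℚₚ.≤-trans
      (∂-columns N ρ θ
        (Unique⇒lookup-injective (S-unique (ℤ.suc i ℤ.- 1ℤ))) (Unique⇒lookup-injective (S-unique (ℤ.suc i)))
        (λ k → ℕₚ.≤-reflexive (dim≡+⇒∣∣≡suc (θ k) (trans (dim-S (ℤ.suc i) k) i+1≡r))) k)
      r+f≤c)
    where
    ρ : Fin (f K (ℤ.suc i ℤ.- 1ℤ)) → Subset n
    ρ = lookup (S K (ℤ.suc i ℤ.- 1ℤ))
    θ : Fin (f K (ℤ.suc i)) → Subset n
    θ = lookup (S K (ℤ.suc i))

corollary1p7 : ∀ (r : ℕ) .{{_ : NonZero r}} {n : ℕ} (K : SimplicialComplex n) →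
    HasDimension K (+ r) →
    ∀ (λ₁ : ℝ) → IsLargestEigenvalue (Lᵘᵖ K (+ r ℤ.- 1ℤ)) λ₁ →
    λ₁ ≤ fromℚ ((+ ℕ.suc r ℚ./ 2) ℚ.* (+ f K (+ r) ℚ./ 1) ℚ.+ (+ f K (+ r ℤ.- + 2) ℚ./ r))
corollary1p7 r@(ℕ.suc _) K ((τ , τ∈K , dimτ≡r) , _) λ₁ (λ₁-eigenvalue , _) =
  Lᵘᵖ-eigenvalue-≤ K (+ r ℤ.- 1ℤ) refl (ℚₚ.≤-trans 1≤r+f r+f≤c) r+f≤c λ₁ λ₁-eigenvalue
  where
  c : ℚ
  c = (+ ℕ.suc r ℚ./ 2) ℚ.* (+ f K (+ r) ℚ./ 1) ℚ.+ (+ f K (+ r ℤ.- + 2) ℚ./ r)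
  ∣τ∣≡1+r : ∣ τ ∣ ≡ ℕ.suc r
  ∣τ∣≡1+r = dim≡+⇒∣∣≡suc τ dimτ≡r
  1≤f : 1 ℕ.≤ f K (+ r)
  1≤f = C≤f K τ∈K 0 (+ r) (trans (ℤₚ.+-identityʳ (+ r)) (sym dimτ≡r))
  -- The faces of codimension 2 in the single r-simplex `τ` number `(r + 1) C 2`.
  r[r+1]≤2f : r ℕ.* ℕ.suc r ℕ.≤ 2 ℕ.* f K (+ r ℤ.- + 2)
  r[r+1]≤2f = subst (ℕ._≤ 2 ℕ.* f K (+ r ℤ.- + 2))
    (trans (cong (λ k → 2 ℕ.* (k C 2)) ∣τ∣≡1+r) (2*[n+1]C2≡n*[n+1] r))
    (ℕₚ.*-monoʳ-≤ 2 (C≤f K τ∈K 2 (+ r ℤ.- + 2) (trans (sub-add (+ r)) (sym dimτ≡r))))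
    where
    sub-add : ∀ z → z ℤ.- + 2 ℤ.+ + 2 ≡ z
    sub-add = solveℤ-∀
  r+f≤c : fromℕ r ℚ.+ fromℕ (f K (+ r)) ℚ.≤ c
  r+f≤c = r+f≤bound r {f K (+ r)} {f K (+ r ℤ.- + 2)} 1≤f r[r+1]≤2f
  1≤r+f : 1ℚ ℚ.≤ fromℕ r ℚ.+ fromℕ (f K (+ r))
  1≤r+f = ℚₚ.+-mono-≤ (fromℕ-mono-≤ {1} {r} (ℕ.s≤s ℕ.z≤n)) (0≤fromℕ (f K (+ r)))
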